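{- Given two curves $\sigma=(v_1,\dots,v_{m'})$ and $\tau=(w_1,\dots,w_{m''})$ in $\mathbb{R}^d$ and a parameter $k\in\mathbb{N}$, for any $0<\varepsilon\le 1$ there exists a $(1+\varepsilon)$-approximation algorithm for $d_{k\text{ - }DTW}(\sigma,\tau)$ (i.e., one that outputs a value $X$ with $d_{k\text{ - }DTW}(\sigma,\tau)\le X\le(1+\varepsilon)\,d_{k\text{ - }DTW}(\sigma,\tau)$) that runs in $O\!\left(m'm''\frac{\log(k/\varepsilon)}{\varepsilon}\right)$ time.
   Context: A traversal of $\sigma$ and $\tau$ is a sequence of index pairs starting with $(1,1)$, ending with $(m',m'')$, where each $(i,j)$ is followed only by $(i+1,j)$, $(i,j+1)$ or $(i+1,j+1)$. For a traversal $T$ let $s^{(T)}_1\ge s^{(T)}_2\ge\dots$ be the Euclidean distances $\|v_i-w_j\|$, $(i,j)\in T$, sorted non-increasingly, padded with zeros beyond $|T|$; $d_{k\text{ - }DTW}(\sigma,\tau)=\min_T\sum_{l=1}^k s^{(T)}_l$. Running time counts distance computations and arithmetic operations as unit cost.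
   Formalization: The running time is bounded by a constant times m'm''·max(1, log₂(k/ε))/ε, since the literal factor log(k/ε) is 0 at k = ε = 1, where no algorithm runs in zero time; curves are nonempty and k ≥ 1, so that the distance and the logarithm are defined. -}

module Defs where

open import Algebra.Bundles using (CommutativeRing; Semiring)
open import Algebra.Structures using (IsCommutativeRing)
import Algebra.Construct.NaturalChoice.Max as Max
import Algebra.Definitions.RawSemiring as RawSemiringDefs
open import Data.Bool.Base using (Bool; true; false; not; if_then_else_)
open import Data.Fin.Base using (Fin; zero; suc; toℕ; fromℕ; fromℕ<; inject₁)
import Data.Fin.Properties as Fin
open import Data.Fin.Induction using (>-weakInduction)
open import Data.List.Base using (List; []; _∷_; map; take; foldr; filter; head; last; length; allFin; cartesianProduct; cartesianProductWith)
import Data.List.Extrema as Extrema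
open import Data.List.Membership.Propositional using (_∈_)
open import Data.List.Membership.Propositional.Properties using (∈-cartesianProduct⁺; ∈-cartesianProductWith⁺; ∈-allFin; ∈-filter⁺; ∈-filter⁻)
import Data.List.Relation.Unary.All as All
open import Data.List.Relation.Unary.Any using (here; there)
open import Data.List.Relation.Unary.Linked as Linked using (Linked; [-]; _∷_)
import Data.List.Sort as Sort
open import Data.Maybe.Base using (Maybe; just; nothing; maybe′)
import Data.Maybe.Properties as Maybe
open import Data.Nat.Base as ℕ using (ℕ; zero; suc; z≤n; s≤s)
import Data.Nat.Properties as ℕ
open import Data.Product.Base using (∃; ∃-syntax; _×_; _,_; proj₁; proj₂)
import Data.Product.Properties as Product
open import Data.Sum.Base using (_⊎_; inj₁; inj₂)
open import Data.Vec.Functional using (Vector)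
open import Level using (0ℓ)
open import Relation.Binary.Bundles using (DecTotalOrder)
import Relation.Binary.Construct.Flip.EqAndOrd as Flip
import Relation.Binary.Construct.NonStrictToStrict as NonStrictToStrict
open import Relation.Binary.PropositionalEquality using (_≡_; refl; sym; cong)
open import Relation.Binary.Structures using (IsDecTotalOrder)
open import Relation.Nullary using (¬_; Dec; does; yes; no; _×-dec_; _⊎-dec_)

------------------------------------------------------------------------
-- Real numbers

-- The classical axioms of the real numbers: a Dedekind-complete totally
-- ordered field, which determines them up to isomorphism.  The order is
-- decidable, as in the real RAM model of computation.  `sup` and `_⁻¹`
-- are total; `sup P` is unconstrained unless P is inhabited and bounded
-- above, and so is 0# ⁻¹.  `archimedean` follows classically from
-- completeness; constructively the witness has to be supplied.

record RealNumbers : Set₁ where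
  infix  4 _≈_ _≤_
  infixl 6 _+_
  infixl 7 _*_
  infix  8 -_
  infix  9 _⁻¹
  field
    Carrier           : Set
    _≈_ _≤_           : Carrier → Carrier → Set
    _+_ _*_           : Carrier → Carrier → Carrier
    -_ _⁻¹            : Carrier → Carrier
    0# 1#             : Carrier
    isCommutativeRing : IsCommutativeRing _≈_ _+_ _*_ -_ 0# 1#
    isDecTotalOrder   : IsDecTotalOrder _≈_ _≤_
    0≉1               : ¬ (0# ≈ 1#)
    ⁻¹-cong           : ∀ {x y} → x ≈ y → x ⁻¹ ≈ y ⁻¹
    *-inverseʳ        : ∀ x → ¬ (x ≈ 0#) → x * x ⁻¹ ≈ 1#
    +-monoˡ-≤         : ∀ z {x y} → x ≤ y → x + z ≤ y + z
    *-nonNeg          : ∀ {x y} → 0# ≤ x → 0# ≤ y → 0# ≤ x * y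

  commutativeRing : CommutativeRing 0ℓ 0ℓ
  commutativeRing = record { isCommutativeRing = isCommutativeRing }

  decTotalOrder : DecTotalOrder 0ℓ 0ℓ 0ℓ
  decTotalOrder = record { isDecTotalOrder = isDecTotalOrder }

  open DecTotalOrder decTotalOrder public using (_≤?_; totalOrder)
  open NonStrictToStrict _≈_ _≤_ public using (_<_)
  open Max totalOrder public using (_⊔_)
  open RawSemiringDefs (Semiring.rawSemiring (CommutativeRing.semiring commutativeRing)) public
    using (_^_) renaming (_×_ to _·_; sum to ∑)

  fromNat : ℕ → Carrier
  fromNat n = n · 1#

  infixl 6 _-_
  _-_ : Carrier → Carrier → Carrier
  x - y = x + (- y)

  infixl 7 _/_
  _/_ : Carrier → Carrier → Carrier
  x / y = x * y ⁻¹

  UpperBound : (Carrier → Set) → Carrier → Set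
  UpperBound P u = ∀ x → P x → x ≤ u

  field
    archimedean : ∀ x → ∃[ n ] x ≤ fromNat n
    sup         : (Carrier → Set) → Carrier
    sup-upper   : ∀ P → ∃ P → ∃ (UpperBound P) → UpperBound P (sup P)
    sup-least   : ∀ P → ∃ P → ∃ (UpperBound P) → ∀ u → UpperBound P u → sup P ≤ u

  -- Meaningful for 0# ≤ x.
  √ : Carrier → Carrier
  √ x = sup λ y → 0# ≤ y × y * y ≤ x

  -- Meaningful for 1# ≤ x: the supremum of the fractions p / q, q ≥ 1,
  -- with 2 ^ p ≤ x ^ q.
  log₂ : Carrier → Carrier
  log₂ x = sup λ r → ∃[ p ] ∃[ q ] 1 ℕ.≤ q × r ≈ fromNat p / fromNat q × fromNat 2 ^ p ≤ x ^ q

------------------------------------------------------------------------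
-- Traversals

-- Indices are 0-based, and n′, n″ are the last indices of the two curves:
-- the curves have suc n′ and suc n″ vertices.

Index : ℕ → ℕ → Set
Index n′ n″ = Fin (suc n′) × Fin (suc n″)

module _ {n′ n″ : ℕ} where

  _↝_ : Index n′ n″ → Index n′ n″ → Set
  (i , j) ↝ (i⁺ , j⁺) =
      (toℕ i⁺ ≡ suc (toℕ i) × toℕ j⁺ ≡ toℕ j)
    ⊎ (toℕ i⁺ ≡ toℕ i       × toℕ j⁺ ≡ suc (toℕ j))
    ⊎ (toℕ i⁺ ≡ suc (toℕ i) × toℕ j⁺ ≡ suc (toℕ j))

  IsTraversal : List (Index n′ n″) → Set
  IsTraversal T =
    Linked _↝_ T × head T ≡ just (zero , zero) × last T ≡ just (fromℕ n′ , fromℕ n″)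

  isTraversal? : ∀ T → Dec (IsTraversal T)
  isTraversal? T = Linked.linked? step? T ×-dec (head T ≟ _) ×-dec (last T ≟ _)
    where
    step? : ∀ x y → Dec (x ↝ y)
    step? (i , j) (i⁺ , j⁺) =
            (toℕ i⁺ ℕ.≟ suc (toℕ i) ×-dec toℕ j⁺ ℕ.≟ toℕ j)
      ⊎-dec (toℕ i⁺ ℕ.≟ toℕ i       ×-dec toℕ j⁺ ℕ.≟ suc (toℕ j))
      ⊎-dec (toℕ i⁺ ℕ.≟ suc (toℕ i) ×-dec toℕ j⁺ ℕ.≟ suc (toℕ j))

    _≟_ : (x y : Maybe (Index n′ n″)) → Dec (x ≡ y)
    _≟_ = Maybe.≡-dec (Product.≡-dec Fin._≟_ Fin._≟_)

  listsUpTo : ℕ → List (List (Index n′ n″))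
  listsUpTo zero    = [] ∷ []
  listsUpTo (suc l) =
    [] ∷ cartesianProductWith _∷_ (cartesianProduct (allFin _) (allFin _)) (listsUpTo l)

  ∈-listsUpTo : ∀ l T → length T ℕ.≤ l → T ∈ listsUpTo l
  ∈-listsUpTo zero    []            _         = here refl
  ∈-listsUpTo (suc l) []            _         = here refl
  ∈-listsUpTo (suc l) ((i , j) ∷ T) (s≤s T≤l) =
    there (∈-cartesianProductWith⁺ _∷_
      (∈-cartesianProduct⁺ (∈-allFin i) (∈-allFin j)) (∈-listsUpTo l T T≤l))

  private
    rank : Index n′ n″ → ℕ
    rank (i , j) = toℕ i ℕ.+ toℕ j

    ↝-rank : ∀ x y → x ↝ y → rank x ℕ.< rank y
    ↝-rank (i , j) _ (inj₁ (p , q)) rewrite p | q = ℕ.≤-refl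
    ↝-rank (i , j) _ (inj₂ (inj₁ (p , q))) rewrite p | q =
      ℕ.≤-reflexive (sym (ℕ.+-suc (toℕ i) (toℕ j)))
    ↝-rank (i , j) _ (inj₂ (inj₂ (p , q))) rewrite p | q =
      s≤s (ℕ.+-monoʳ-≤ (toℕ i) (ℕ.n≤1+n (toℕ j)))

    rank+length≤ : ∀ x T → Linked _↝_ (x ∷ T) → rank x ℕ.+ length T ℕ.≤ n′ ℕ.+ n″
    rank+length≤ (i , j) [] _ = ℕ.≤-trans (ℕ.≤-reflexive (ℕ.+-identityʳ _))
      (ℕ.+-mono-≤ (Fin.toℕ≤pred[n] i) (Fin.toℕ≤pred[n] j))
    rank+length≤ x (y ∷ T) (x↝y ∷ L) = ℕ.≤-trans
      (ℕ.≤-reflexive (ℕ.+-suc (rank x) (length T)))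
      (ℕ.≤-trans (ℕ.+-monoˡ-≤ (length T) (↝-rank x y x↝y)) (rank+length≤ y T L))

    ReachesEnd : Index n′ n″ → Set
    ReachesEnd x = ∃[ T ] Linked _↝_ (x ∷ T) × last (x ∷ T) ≡ just (fromℕ n′ , fromℕ n″)

    reachesEnd : ∀ j i → ReachesEnd (i , j)
    reachesEnd = >-weakInduction (λ j → ∀ i → ReachesEnd (i , j)) topRow λ j below i →
      let (T , L , e) = below i
      in _ ∷ T , inj₂ (inj₁ (refl , cong suc (sym (Fin.toℕ-inject₁ j)))) ∷ L , e
      where
      topRow : ∀ i → ReachesEnd (i , fromℕ n″)
      topRow = >-weakInduction (λ i → ReachesEnd (i , fromℕ n″)) ([] , [-] , refl)
        λ { i (T , L , e) → _ ∷ T , inj₁ (cong suc (sym (Fin.toℕ-inject₁ i)) , refl) ∷ L , e }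

  length-traversal : ∀ T → IsTraversal T → length T ℕ.≤ suc (n′ ℕ.+ n″)
  length-traversal ((zero , zero) ∷ T) (L , refl , _) = s≤s (rank+length≤ _ T L)

  someTraversal : ∃ IsTraversal
  someTraversal = let (T , L , e) = reachesEnd zero zero in _ ∷ T , L , refl , e

  traversals : List (List (Index n′ n″))
  traversals = filter isTraversal? (listsUpTo (suc (n′ ℕ.+ n″)))

  traversals-complete : ∀ T → IsTraversal T → T ∈ traversals
  traversals-complete T t = ∈-filter⁺ isTraversal? (∈-listsUpTo _ T (length-traversal T t)) t

  traversals-sound : ∀ {T} → T ∈ traversals → IsTraversal T
  traversals-sound T∈ = proj₂ (∈-filter⁻ isTraversal? {xs = listsUpTo (suc (n′ ℕ.+ n″))} T∈)

------------------------------------------------------------------------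
-- k-DTW

module KDTW (ℝ : RealNumbers) where
  open RealNumbers ℝ

  Point : ℕ → Set
  Point d = Vector Carrier d

  Curve : ℕ → ℕ → Set
  Curve d m = Vector (Point d) m

  ‖_-_‖ : ∀ {d} → Point d → Point d → Carrier
  ‖ v - w ‖ = √ (∑ λ c → (v c - w c) * (v c - w c))

  sortNonIncreasing : List Carrier → List Carrier
  sortNonIncreasing = Sort.sort (Flip.decTotalOrder decTotalOrder)

  module _ {d n′ n″ : ℕ} (k : ℕ) (σ : Curve d (suc n′)) (τ : Curve d (suc n″)) where

    -- `take k` returns the whole list when k exceeds its length, which
    -- agrees with padding by zeros since the entries are summed.
    cost : List (Index n′ n″) → Carrier
    cost T = foldr _+_ 0# (take k (sortNonIncreasing (map (λ (i , j) → ‖ σ i - τ j ‖) T)))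

    private
      optimal : List (Index n′ n″)
      optimal = Extrema.argmin totalOrder cost (proj₁ someTraversal) traversals

    kDTW : Carrier
    kDTW = cost optimal

    kDTW-attained : ∃[ T ] IsTraversal T × kDTW ≡ cost T
    kDTW-attained = optimal
      , Extrema.argmin-all totalOrder cost (proj₂ someTraversal) (All.tabulate traversals-sound)
      , refl

    kDTW-minimal : ∀ T → IsTraversal T → kDTW ≤ cost T
    kDTW-minimal T t = All.lookup
      (Extrema.f[argmin]≤f[xs] totalOrder (proj₁ someTraversal) traversals)
      (traversals-complete T t)

------------------------------------------------------------------------
-- Real RAM programs

-- The memory consists of integer registers and of real arrays.  A program
-- is a fixed piece of syntax: it cannot depend on the input, contains no
-- real constants other than naturals, and learns about reals only through
-- comparisons.

infixr 1 _⨾_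
infix  2 IF_THEN_ELSE_ WHILE_DO_
infix  3 _≔_ _[_]≔_
infix  4 _≤ᵢ_ _≤ᵣ_
infixl 6 _⊕_ _⊖_ _⊞_ _⊟_
infixl 7 _⊠_ _⊘_
infix  9 _[_]

data IntExp : Set where
  lit     : ℕ → IntExp
  reg     : ℕ → IntExp
  _⊕_ _⊖_ : IntExp → IntExp → IntExp

data RealExp : Set where
  cast            : IntExp → RealExp
  _[_]            : ℕ → IntExp → RealExp
  _⊞_ _⊟_ _⊠_ _⊘_ : RealExp → RealExp → RealExp
  coord₁ coord₂   : (vertex coordinate : IntExp) → RealExp
  dist            : IntExp → IntExp → RealExp

data Test : Set where
  _≤ᵢ_ : IntExp → IntExp → Test
  _≤ᵣ_ : RealExp → RealExp → Test
  neg  : Test → Test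

data Program : Set where
  SKIP          : Program
  _≔_           : ℕ → IntExp → Program
  _[_]≔_        : ℕ → IntExp → RealExp → Program
  _⨾_           : Program → Program → Program
  IF_THEN_ELSE_ : Test → Program → Program → Program
  WHILE_DO_     : Test → Program → Program

-- Every operation, memory access, constant and distance evaluation in an
-- expression costs one unit.

sizeᵢ : IntExp → ℕ
sizeᵢ (lit _)   = 1
sizeᵢ (reg _)   = 1
sizeᵢ (e ⊕ e₁)  = suc (sizeᵢ e ℕ.+ sizeᵢ e₁)
sizeᵢ (e ⊖ e₁)  = suc (sizeᵢ e ℕ.+ sizeᵢ e₁)

sizeᵣ : RealExp → ℕ
sizeᵣ (cast e)      = suc (sizeᵢ e)
sizeᵣ (_ [ e ])     = suc (sizeᵢ e)
sizeᵣ (e ⊞ e₁)      = suc (sizeᵣ e ℕ.+ sizeᵣ e₁)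
sizeᵣ (e ⊟ e₁)      = suc (sizeᵣ e ℕ.+ sizeᵣ e₁)
sizeᵣ (e ⊠ e₁)      = suc (sizeᵣ e ℕ.+ sizeᵣ e₁)
sizeᵣ (e ⊘ e₁)      = suc (sizeᵣ e ℕ.+ sizeᵣ e₁)
sizeᵣ (coord₁ e e₁) = suc (sizeᵢ e ℕ.+ sizeᵢ e₁)
sizeᵣ (coord₂ e e₁) = suc (sizeᵢ e ℕ.+ sizeᵢ e₁)
sizeᵣ (dist e e₁)   = suc (sizeᵢ e ℕ.+ sizeᵢ e₁)

sizeₜ : Test → ℕ
sizeₜ (e ≤ᵢ e₁) = suc (sizeᵢ e ℕ.+ sizeᵢ e₁)
sizeₜ (e ≤ᵣ e₁) = suc (sizeᵣ e ℕ.+ sizeᵣ e₁)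
sizeₜ (neg b)   = suc (sizeₜ b)

lookup? : ∀ {A : Set} {m} → Vector A m → ℕ → Maybe A
lookup? {m = m} f i with i ℕ.<? m
... | yes i<m = just (f (fromℕ< i<m))
... | no  _   = nothing

module Execution (ℝ : RealNumbers) where
  open RealNumbers ℝ
  open KDTW ℝ using (Point; Curve; ‖_-_‖)

  record State : Set where
    constructor ⟪_,_⟫
    field
      int  : ℕ → ℕ
      real : ℕ → ℕ → Carrier
  open State public

  setInt : ℕ → ℕ → State → State
  setInt x v s = ⟪ (λ y → if does (x ℕ.≟ y) then v else int s y) , real s ⟫

  setReal : ℕ → ℕ → Carrier → State → State
  setReal a i v s = ⟪ int s , (λ b j →
    if does (a ℕ.≟ b) then (if does (i ℕ.≟ j) then v else real s b j) else real s b j) ⟫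

  module _ {d m′ m″ : ℕ} (σ : Curve d m′) (τ : Curve d m″) where

    -- Registers 0 to 3 hold the two lengths, k and the dimension; ε is in
    -- cell 0 of array 0.
    initial : ℕ → Carrier → State
    initial k ε = ⟪ ints , reals ⟫
      where
      ints : ℕ → ℕ
      ints 0 = m′
      ints 1 = m″
      ints 2 = k
      ints 3 = d
      ints _ = 0

      reals : ℕ → ℕ → Carrier
      reals 0 0 = ε
      reals _ _ = 0#

    evalᵢ : IntExp → State → ℕ
    evalᵢ (lit n)  s = n
    evalᵢ (reg x)  s = int s x
    evalᵢ (e ⊕ e₁) s = evalᵢ e s ℕ.+ evalᵢ e₁ s
    evalᵢ (e ⊖ e₁) s = evalᵢ e s ℕ.∸ evalᵢ e₁ s

    -- Vertices and coordinates are numbered from 0; an access out of range yields 0#.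
    coordinate : ∀ {m} → Curve d m → ℕ → ℕ → Carrier
    coordinate ρ i c = maybe′ (λ v → maybe′ (λ x → x) 0# (lookup? v c)) 0# (lookup? ρ i)

    distance : ℕ → ℕ → Carrier
    distance i j = maybe′ (λ v → maybe′ (λ w → ‖ v - w ‖) 0# (lookup? τ j)) 0# (lookup? σ i)

    evalᵣ : RealExp → State → Carrier
    evalᵣ (cast e)      s = fromNat (evalᵢ e s)
    evalᵣ (a [ e ])     s = real s a (evalᵢ e s)
    evalᵣ (e ⊞ e₁)      s = evalᵣ e s + evalᵣ e₁ s
    evalᵣ (e ⊟ e₁)      s = evalᵣ e s - evalᵣ e₁ s
    evalᵣ (e ⊠ e₁)      s = evalᵣ e s * evalᵣ e₁ s
    evalᵣ (e ⊘ e₁)      s = evalᵣ e s / evalᵣ e₁ s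
    evalᵣ (coord₁ e e₁) s = coordinate σ (evalᵢ e s) (evalᵢ e₁ s)
    evalᵣ (coord₂ e e₁) s = coordinate τ (evalᵢ e s) (evalᵢ e₁ s)
    evalᵣ (dist e e₁)   s = distance (evalᵢ e s) (evalᵢ e₁ s)

    evalₜ : Test → State → Bool
    evalₜ (e ≤ᵢ e₁) s = does (evalᵢ e s ℕ.≤? evalᵢ e₁ s)
    evalₜ (e ≤ᵣ e₁) s = does (evalᵣ e s ≤? evalᵣ e₁ s)
    evalₜ (neg b)   s = not (evalₜ b s)

    -- Run P s s′ t: started in state s, program P halts in state s′ after
    -- t steps.
    data Run : Program → State → State → ℕ → Set where
      skip       : ∀ {s} → Run SKIP s s 1
      assignInt  : ∀ {x e s} → Run (x ≔ e) s (setInt x (evalᵢ e s) s) (suc (sizeᵢ e))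
      assignReal : ∀ {a e r s} →
                   Run (a [ e ]≔ r) s (setReal a (evalᵢ e s) (evalᵣ r s) s)
                       (suc (sizeᵢ e ℕ.+ sizeᵣ r))
      seq        : ∀ {P Q s s₁ s₂ t₁ t₂} → Run P s s₁ t₁ → Run Q s₁ s₂ t₂ →
                   Run (P ⨾ Q) s s₂ (t₁ ℕ.+ t₂)
      ifTrue     : ∀ {b P Q s s₁ t} → evalₜ b s ≡ true → Run P s s₁ t →
                   Run (IF b THEN P ELSE Q) s s₁ (suc (sizeₜ b ℕ.+ t))
      ifFalse    : ∀ {b P Q s s₁ t} → evalₜ b s ≡ false → Run Q s s₁ t →
                   Run (IF b THEN P ELSE Q) s s₁ (suc (sizeₜ b ℕ.+ t))
      whileDone  : ∀ {b P s} → evalₜ b s ≡ false →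
                   Run (WHILE b DO P) s s (suc (sizeₜ b))
      whileLoop  : ∀ {b P s s₁ s₂ t₁ t₂} → evalₜ b s ≡ true → Run P s s₁ t₁ →
                   Run (WHILE b DO P) s₁ s₂ t₂ →
                   Run (WHILE b DO P) s s₂ (suc (sizeₜ b ℕ.+ (t₁ ℕ.+ t₂)))

  output : State → Carrier
  output s = real s 0 0

{-# OPTIONS --safe #-}

-- For every θ ≥ 0 the sum of the k largest of some distances is at most
-- kθ + Σ max(w - θ, 0), with equality when θ is the k-th largest.  For fixed θ the
-- right-hand side is minimised over all traversals by dynamic programming in time
-- O(m′m″), and it grows by a factor of at most 1 + ε when θ does.
-- The discrete Fréchet distance F, computed by the same dynamic program, satisfies
-- F ≤ kDTW ≤ kF, so the optimal θ is at most F, and every θ below εF/k may be replaced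
-- by εF/k at the price of an additive ε·kDTW.  Hence it suffices to try
-- the O(log(k/ε)/ε) thresholds (1 + ε)^i εF/k up to F.

module Submission where

open import Defs
import Algebra.Construct.NaturalChoice.Max as Max
import Algebra.Construct.NaturalChoice.MaxOp as MaxOp
open import Algebra.Bundles using (CommutativeRing)
import Algebra.Properties.Ring as RingProperties
import Algebra.Properties.Semiring.Exp as Exp
import Algebra.Properties.Semiring.Mult as Mult
import Algebra.Solver.Ring.NaturalCoefficients.Default as Solver
open import Data.Bool.Base using (true; false; not; if_then_else_)
open import Data.Empty using (⊥-elim)
open import Data.Fin.Base using (Fin; zero; suc; toℕ; fromℕ; fromℕ<)
import Data.Fin.Properties as Fin
open import Data.List.Base using (List; []; _∷_; map; take; foldr; last)
open import Data.List.Relation.Binary.Permutation.Propositional as ↭ using (_↭_; prep; swap; ↭-sym)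
open import Data.List.Relation.Binary.Permutation.Propositional.Properties using (All-resp-↭)
open import Data.List.Relation.Unary.All as All using (All; []; _∷_)
import Data.List.Relation.Unary.All.Properties as All
open import Data.List.Relation.Unary.AllPairs using (AllPairs; []; _∷_)
open import Data.List.Relation.Unary.Linked using (Linked; [-]; _∷_)
open import Data.List.Relation.Unary.Sorted.TotalOrder.Properties using (Sorted⇒AllPairs)
import Data.List.Sort as Sort
open import Data.Maybe.Base using (just)
open import Data.Nat.Base as ℕ using (ℕ; zero; suc; z≤n; s≤s)
import Data.Nat.Properties as ℕ
open import Data.Nat.Tactic.RingSolver using (solve-∀)
open import Data.Product.Base using (∃-syntax; _×_; _,_; proj₁; proj₂)
open import Data.Sum.Base using (inj₁; inj₂)
open import Data.Vec.Functional using (Vector)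
open import Function.Base using (_∘_; flip)
open import Relation.Binary.Bundles using (DecTotalOrder)
import Relation.Binary.Construct.Flip.EqAndOrd as Flip
open import Relation.Binary.PropositionalEquality as ≡ using (_≡_)
import Relation.Binary.Reasoning.PartialOrder as PosetReasoning
open import Relation.Nullary using (¬_; Dec; does; yes; no; contradiction)
open import Relation.Nullary.Decidable using (dec-true; dec-false)

-- Which distances count among the k largest depends on the whole traversal, so the cost itself has
-- no recursion along a traversal; the excess over a fixed θ accumulates pair by pair and has one.
-- Raising θ to a grid point never increases the excess of the same traversal, so only the term kθ
-- has to be controlled. If F = 0, the first threshold is 0 and already reaches F, so the search
-- stops before its first pass. Field identities hold only up to `≈`, whereas program states are
-- compared by `≡`. The functions that the program evaluates (`lift`, `minimum`, `grid`) therefore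
-- copy its expressions and tests literally, and `≈` is confined to the estimates.

-- The failure of `P` below the result makes it quantitative: at the predecessor the inequality is
-- reversed. This limits the doubling time, the power of 2 and the first grid point above a
-- threshold.
least : (P : ℕ → Set) → (∀ n → Dec (P n)) → ∀ n → P n →
        ∃[ m ] m ℕ.≤ n × P m × (∀ i → i ℕ.< m → ¬ P i)
least P P? n p with P? 0
... | yes p₀ = 0 , z≤n , p₀ , λ _ ()
least P P? zero    p | no ¬p₀ = contradiction p ¬p₀
least P P? (suc n) p | no ¬p₀ with least (P ∘ suc) (P? ∘ suc) n p
... | m , m≤n , pₘ , below = suc m , s≤s m≤n , pₘ , λ where
        zero    _         → ¬p₀
        (suc i) (s≤s i<m) → below i i<m

-- Ordered field arithmetic, square roots, powers and logarithms.

module RealProperties (ℝ : RealNumbers) where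
  open RealNumbers ℝ
  open CommutativeRing commutativeRing public
    using ( ring; semiring; commutativeSemiring; +-congˡ; +-congʳ; +-comm; +-assoc
          ; +-identityˡ; +-identityʳ; -‿inverseˡ; -‿inverseʳ; *-cong; *-congˡ; *-congʳ; *-comm; *-assoc
          ; *-identityˡ; *-identityʳ; zeroˡ; zeroʳ; distribˡ; -‿cong; refl; sym; trans)
  open RingProperties ring public using (-‿distribˡ-*; -‿distribʳ-*; -‿involutive)
  open Mult semiring public using (×1-homo-*)
  open Exp semiring public using (^-assocʳ)
  open DecTotalOrder decTotalOrder public using (poset; total; antisym)
    renaming (refl to ≤-refl; trans to ≤-trans; reflexive to ≤-reflexive)
  open PosetReasoning poset public
  open Solver commutativeSemiring public using (solve; _:=_; _:+_; _:*_; con)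

  ≰⇒≥ : ∀ {x y} → ¬ x ≤ y → y ≤ x
  ≰⇒≥ {x} {y} x≰y with total x y
  ... | inj₁ x≤y = contradiction x≤y x≰y
  ... | inj₂ y≤x = y≤x

  +-monoʳ-≤ : ∀ z {x y} → x ≤ y → z + x ≤ z + y
  +-monoʳ-≤ z {x} {y} x≤y = begin
    z + x ≈⟨ +-comm z x ⟩
    x + z ≤⟨ +-monoˡ-≤ z x≤y ⟩
    y + z ≈⟨ +-comm y z ⟩
    z + y ∎

  +-mono-≤ : ∀ {x y u v} → x ≤ y → u ≤ v → x + u ≤ y + v
  +-mono-≤ {y = y} {u = u} x≤y u≤v = ≤-trans (+-monoˡ-≤ u x≤y) (+-monoʳ-≤ y u≤v)

  [x-y]+y≈x : ∀ x y → (x - y) + y ≈ x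
  [x-y]+y≈x x y = begin-equality
    (x + - y) + y ≈⟨ +-assoc x (- y) y ⟩
    x + (- y + y) ≈⟨ +-congˡ (-‿inverseˡ y) ⟩
    x + 0#        ≈⟨ +-identityʳ x ⟩
    x             ∎

  [x+y]-y≈x : ∀ x y → (x + y) - y ≈ x
  [x+y]-y≈x x y = begin-equality
    (x + y) + - y ≈⟨ +-assoc x y (- y) ⟩
    x + (y + - y) ≈⟨ +-congˡ (-‿inverseʳ y) ⟩
    x + 0#        ≈⟨ +-identityʳ x ⟩
    x             ∎

  +-cancelʳ-≤ : ∀ z {x y} → x + z ≤ y + z → x ≤ y
  +-cancelʳ-≤ z {x} {y} le = begin
    x           ≈⟨ [x+y]-y≈x x z ⟨
    (x + z) - z ≤⟨ +-monoˡ-≤ (- z) le ⟩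
    (y + z) - z ≈⟨ [x+y]-y≈x y z ⟩
    y           ∎

  +-cancelˡ-≤ : ∀ z {x y} → z + x ≤ z + y → x ≤ y
  +-cancelˡ-≤ z {x} {y} le = +-cancelʳ-≤ z (begin
    x + z ≈⟨ +-comm x z ⟩
    z + x ≤⟨ le ⟩
    z + y ≈⟨ +-comm z y ⟩
    y + z ∎)

  x≤y⇒0≤y-x : ∀ {x y} → x ≤ y → 0# ≤ y - x
  x≤y⇒0≤y-x {x} {y} x≤y = +-cancelʳ-≤ x (begin
    0# + x      ≈⟨ +-identityˡ x ⟩
    x           ≤⟨ x≤y ⟩
    y           ≈⟨ [x-y]+y≈x y x ⟨
    (y - x) + x ∎)

  x≤x+y : ∀ {x y} → 0# ≤ y → x ≤ x + y
  x≤x+y {x} {y} 0≤y = ≤-trans (≤-reflexive (sym (+-identityʳ x))) (+-monoʳ-≤ x 0≤y)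

  +-nonNeg : ∀ {x y} → 0# ≤ x → 0# ≤ y → 0# ≤ x + y
  +-nonNeg 0≤x 0≤y = ≤-trans 0≤x (x≤x+y 0≤y)

  *-monoʳ-≤ : ∀ {z x y} → 0# ≤ z → x ≤ y → z * x ≤ z * y
  *-monoʳ-≤ {z} {x} {y} 0≤z x≤y = begin
    z * x               ≤⟨ x≤x+y (*-nonNeg 0≤z (x≤y⇒0≤y-x x≤y)) ⟩
    z * x + z * (y - x) ≈⟨ distribˡ z x (y - x) ⟨
    z * (x + (y - x))   ≈⟨ *-congˡ (trans (+-comm x (y - x)) ([x-y]+y≈x y x)) ⟩
    z * y               ∎

  *-monoˡ-≤ : ∀ {z x y} → 0# ≤ z → x ≤ y → x * z ≤ y * z
  *-monoˡ-≤ {z} {x} {y} 0≤z x≤y = begin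
    x * z ≈⟨ *-comm x z ⟩
    z * x ≤⟨ *-monoʳ-≤ 0≤z x≤y ⟩
    z * y ≈⟨ *-comm z y ⟩
    y * z ∎

  *-mono-≤ : ∀ {x y u v} → 0# ≤ y → 0# ≤ u → x ≤ y → u ≤ v → x * u ≤ y * v
  *-mono-≤ 0≤y 0≤u x≤y u≤v = ≤-trans (*-monoˡ-≤ 0≤u x≤y) (*-monoʳ-≤ 0≤y u≤v)

  square-nonNeg : ∀ x → 0# ≤ x * x
  square-nonNeg x with total 0# x
  ... | inj₁ 0≤x = *-nonNeg 0≤x 0≤x
  ... | inj₂ x≤0 = begin
    0#            ≤⟨ *-nonNeg 0≤-x 0≤-x ⟩
    (- x) * (- x) ≈⟨ -‿distribˡ-* x (- x) ⟨
    - (x * - x)   ≈⟨ -‿cong (sym (-‿distribʳ-* x x)) ⟩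
    - (- (x * x)) ≈⟨ -‿involutive (x * x) ⟩
    x * x         ∎
    where
    0≤-x : 0# ≤ - x
    0≤-x = ≤-trans (x≤y⇒0≤y-x x≤0) (≤-reflexive (+-identityˡ (- x)))

  0≤1 : 0# ≤ 1#
  0≤1 = ≤-trans (square-nonNeg 1#) (≤-reflexive (*-identityʳ 1#))

  1≰0 : ¬ 1# ≤ 0#
  1≰0 1≤0 = 0≉1 (antisym 0≤1 1≤0)

  fromNat-nonNeg : ∀ n → 0# ≤ fromNat n
  fromNat-nonNeg zero    = ≤-refl
  fromNat-nonNeg (suc n) = +-nonNeg 0≤1 (fromNat-nonNeg n)

  fromNat-mono : ∀ {m n} → m ℕ.≤ n → fromNat m ≤ fromNat n
  fromNat-mono {n = n} z≤n = fromNat-nonNeg n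
  fromNat-mono (s≤s m≤n)   = +-monoʳ-≤ 1# (fromNat-mono m≤n)

  fromNat-reflects : ∀ m n → fromNat m ≤ fromNat n → m ℕ.≤ n
  fromNat-reflects m n le with m ℕ.≤? n
  ... | yes m≤n = m≤n
  ... | no  m≰n = contradiction
    (+-cancelʳ-≤ (fromNat n) (begin
      1# + fromNat n ≤⟨ fromNat-mono (ℕ.≰⇒> m≰n) ⟩
      fromNat m      ≤⟨ le ⟩
      fromNat n      ≈⟨ +-identityˡ (fromNat n) ⟨
      0# + fromNat n ∎))
    1≰0

  0<fromNat : ∀ {n} → 1 ℕ.≤ n → 0# < fromNat n
  0<fromNat {n} 1≤n = fromNat-nonNeg n , λ 0≈n → 1≰0 (begin
    1#        ≈⟨ +-identityʳ 1# ⟨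
    fromNat 1 ≤⟨ fromNat-mono 1≤n ⟩
    fromNat n ≈⟨ 0≈n ⟨
    0#        ∎)

  0<⇒*-inverseʳ : ∀ {x} → 0# < x → x * x ⁻¹ ≈ 1#
  0<⇒*-inverseʳ (_ , 0≉x) = *-inverseʳ _ (0≉x ∘ sym)

  ⁻¹-nonNeg : ∀ {x} → 0# < x → 0# ≤ x ⁻¹
  ⁻¹-nonNeg {x} 0<x with total 0# (x ⁻¹)
  ... | inj₁ 0≤x⁻¹ = 0≤x⁻¹
  ... | inj₂ x⁻¹≤0 = ⊥-elim (1≰0 (begin
    1#       ≈⟨ 0<⇒*-inverseʳ 0<x ⟨
    x * x ⁻¹ ≤⟨ *-monoʳ-≤ (proj₁ 0<x) x⁻¹≤0 ⟩
    x * 0#   ≈⟨ zeroʳ x ⟩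
    0#       ∎))

  y*[x/y]≈x : ∀ x {y} → 0# < y → y * (x / y) ≈ x
  y*[x/y]≈x x {y} 0<y = begin-equality
    y * (x * y ⁻¹) ≈⟨ solve 3 (λ x y z → y :* (x :* z) := x :* (y :* z)) refl x y (y ⁻¹) ⟩
    x * (y * y ⁻¹) ≈⟨ *-congˡ (0<⇒*-inverseʳ 0<y) ⟩
    x * 1#         ≈⟨ *-identityʳ x ⟩
    x              ∎

  *-cancelˡ-≤ : ∀ {z x y} → 0# < z → z * x ≤ z * y → x ≤ y
  *-cancelˡ-≤ {z} {x} {y} 0<z le = begin
    x                ≈⟨ y*[x/y]≈x x 0<z ⟨
    z * (x * z ⁻¹)   ≈⟨ *-assoc z x (z ⁻¹) ⟨
    z * x * z ⁻¹     ≤⟨ *-monoˡ-≤ (⁻¹-nonNeg 0<z) le ⟩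
    z * y * z ⁻¹     ≈⟨ *-assoc z y (z ⁻¹) ⟩
    z * (y * z ⁻¹)   ≈⟨ y*[x/y]≈x y 0<z ⟩
    y                ∎

  ∑-nonNeg : ∀ {n} (f : Vector Carrier n) → (∀ i → 0# ≤ f i) → 0# ≤ ∑ f
  ∑-nonNeg {zero}  f 0≤f = ≤-refl
  ∑-nonNeg {suc n} f 0≤f = +-nonNeg (0≤f _) (∑-nonNeg (f ∘ suc) (0≤f ∘ suc))

  -- A supremum says something only for an inhabited bounded set: 0 is a member, and a member `y`
  -- satisfies `y ≤ 1#` or `y ≤ y * y ≤ x`.
  √-nonNeg : ∀ {x} → 0# ≤ x → 0# ≤ √ x
  √-nonNeg {x} 0≤x = sup-upper _ (0# , 0-in) (1# + x , bounded) 0# 0-in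
    where
    0-in : 0# ≤ 0# × 0# * 0# ≤ x
    0-in = ≤-refl , ≤-trans (≤-reflexive (zeroˡ 0#)) 0≤x

    bounded : UpperBound (λ y → 0# ≤ y × y * y ≤ x) (1# + x)
    bounded y (0≤y , y²≤x) with total y 1#
    ... | inj₁ y≤1 = ≤-trans y≤1 (x≤x+y 0≤x)
    ... | inj₂ 1≤y = begin
      y      ≈⟨ *-identityʳ y ⟨
      y * 1# ≤⟨ *-monoʳ-≤ 0≤y 1≤y ⟩
      y * y  ≤⟨ y²≤x ⟩
      x      ≤⟨ x≤x+y 0≤1 ⟩
      x + 1# ≈⟨ +-comm x 1# ⟩
      1# + x ∎

  ^-nonNeg : ∀ {x} n → 0# ≤ x → 0# ≤ x ^ n
  ^-nonNeg zero    0≤x = 0≤1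
  ^-nonNeg (suc n) 0≤x = *-nonNeg 0≤x (^-nonNeg n 0≤x)

  ^-monoˡ-≤ : ∀ {x y} n → 0# ≤ x → x ≤ y → x ^ n ≤ y ^ n
  ^-monoˡ-≤ zero    0≤x x≤y = ≤-refl
  ^-monoˡ-≤ (suc n) 0≤x x≤y =
    *-mono-≤ (≤-trans 0≤x x≤y) (^-nonNeg n 0≤x) x≤y (^-monoˡ-≤ n 0≤x x≤y)

  -- Shows that about 1/ε factors `1# + ε` suffice to double a threshold. The induction step
  -- discards `N * (x * x)`.
  bernoulli : ∀ {x} → 0# ≤ x → ∀ n → 1# + fromNat n * x ≤ (1# + x) ^ n
  bernoulli {x} 0≤x zero    = ≤-reflexive (trans (+-congˡ (zeroˡ x)) (+-identityʳ 1#))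
  bernoulli {x} 0≤x (suc n) = begin
    1# + (1# + N) * x
      ≤⟨ x≤x+y (*-nonNeg (fromNat-nonNeg n) (square-nonNeg x)) ⟩
    1# + (1# + N) * x + N * (x * x)
      ≈⟨ solve 2 (λ x N → con 1 :+ (con 1 :+ N) :* x :+ N :* (x :* x)
                       := (con 1 :+ x) :* (con 1 :+ N :* x)) refl x N ⟩
    (1# + x) * (1# + N * x)
      ≤⟨ *-monoʳ-≤ (+-nonNeg 0≤1 0≤x) (bernoulli 0≤x n) ⟩
    (1# + x) * (1# + x) ^ n ∎
    where N = fromNat n

  fromNat-^ : ∀ m n → fromNat (m ℕ.^ n) ≈ fromNat m ^ n
  fromNat-^ m zero    = +-identityʳ 1#
  fromNat-^ m (suc n) = trans (×1-homo-* m (m ℕ.^ n)) (*-congˡ (fromNat-^ m n))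

  fromNat≤2^ : ∀ n → fromNat n ≤ fromNat 2 ^ n
  fromNat≤2^ n = ≤-trans (fromNat-mono (n≤2^n n)) (≤-reflexive (fromNat-^ 2 n))
    where
    n≤2^n : ∀ n → n ℕ.≤ 2 ℕ.^ n
    n≤2^n n = ℕ.<⇒≤ (n<2^n n)
      where
      n<2^n : ∀ n → n ℕ.< 2 ℕ.^ n
      n<2^n zero    = s≤s z≤n
      n<2^n (suc n) = ℕ.≤-trans (ℕ.+-mono-≤ (ℕ.m^n>0 2 n) (n<2^n n))
        (ℕ.+-monoʳ-≤ (2 ℕ.^ n) (ℕ.m≤m+n _ _))

  -- From `x ≤ n ≤ 2 ^ n` follows `2 ^ p ≤ 2 ^ (n q)`, and these powers are compared in ℕ. It bounds
  -- the set of fractions whose supremum is `log₂ x`.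
  2^-exp-bound : ∀ {x} n → 0# ≤ x → x ≤ fromNat n → ∀ p q →
                 fromNat 2 ^ p ≤ x ^ q → p ℕ.≤ n ℕ.* q
  2^-exp-bound {x} n 0≤x x≤n p q 2^p≤x^q = ℕ.≮⇒≥ λ nq<p →
    ℕ.<⇒≱ (ℕ.^-monoʳ-< 2 (s≤s (s≤s z≤n)) nq<p) (fromNat-reflects _ _ (begin
      fromNat (2 ℕ.^ p)         ≈⟨ fromNat-^ 2 p ⟩
      fromNat 2 ^ p             ≤⟨ 2^p≤x^q ⟩
      x ^ q                     ≤⟨ ^-monoˡ-≤ q 0≤x (≤-trans x≤n (fromNat≤2^ n)) ⟩
      (fromNat 2 ^ n) ^ q       ≈⟨ ^-assocʳ (fromNat 2) n q ⟩
      fromNat 2 ^ (n ℕ.* q)     ≈⟨ fromNat-^ 2 (n ℕ.* q) ⟨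
      fromNat (2 ℕ.^ (n ℕ.* q)) ∎))

  -- The fraction `a / 1` belongs to the set defining `log₂ x`; the rest of the proof supplies the
  -- upper bound `n` that `sup-upper` asks for.
  2^a≤x⇒a≤log₂x : ∀ {x} a → fromNat 2 ^ a ≤ x → fromNat a ≤ log₂ x
  2^a≤x⇒a≤log₂x {x} a 2^a≤x = sup-upper _ (fromNat a , in-a) (fromNat n , bounded) (fromNat a) in-a
    where
    0≤x : 0# ≤ x
    0≤x = ≤-trans (^-nonNeg a (fromNat-nonNeg 2)) 2^a≤x

    n   = proj₁ (archimedean x)
    x≤n = proj₂ (archimedean x)

    in-a : ∃[ p ] ∃[ q ] 1 ℕ.≤ q × fromNat a ≈ fromNat p / fromNat q × fromNat 2 ^ p ≤ x ^ q
    in-a = a , 1 , s≤s z≤n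
      , trans (sym (y*[x/y]≈x (fromNat a) (0<fromNat {1} (s≤s z≤n))))
              (trans (*-congʳ (+-identityʳ 1#)) (*-identityˡ _))
      , ≤-trans 2^a≤x (≤-reflexive (sym (*-identityʳ x)))

    bounded : ∀ r → ∃[ p ] ∃[ q ] 1 ℕ.≤ q × r ≈ fromNat p / fromNat q × fromNat 2 ^ p ≤ x ^ q → r ≤ fromNat n
    bounded r (p , q , 1≤q , r≈p/q , 2^p≤x^q) = *-cancelˡ-≤ (0<fromNat 1≤q) (begin
      fromNat q * r                       ≈⟨ *-congˡ r≈p/q ⟩
      fromNat q * (fromNat p / fromNat q) ≈⟨ y*[x/y]≈x (fromNat p) (0<fromNat 1≤q) ⟩
      fromNat p                           ≤⟨ fromNat-mono (2^-exp-bound n 0≤x x≤n p q 2^p≤x^q) ⟩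
      fromNat (n ℕ.* q)                   ≈⟨ ×1-homo-* n q ⟩
      fromNat n * fromNat q               ≈⟨ *-comm (fromNat n) (fromNat q) ⟩
      fromNat q * fromNat n               ∎)

-- Sums of the k largest entries by thresholds.

module Thresholds (ℝ : RealNumbers) where
  open RealNumbers ℝ
  open RealProperties ℝ

  -- lift θ w p = p + max (w - θ) 0, the least b with p ≤ b and w + p ≤ θ + b;
  -- in particular lift p w p is the maximum of w and p.
  lift : Carrier → Carrier → Carrier → Carrier
  lift θ w p = if does (w ≤? θ) then p else p + (w - θ)

  p≤lift : ∀ θ w p → p ≤ lift θ w p
  p≤lift θ w p with w ≤? θ
  ... | yes _   = ≤-refl
  ... | no  w≰θ = x≤x+y (x≤y⇒0≤y-x (≰⇒≥ w≰θ))

  θ+[p+[w-θ]]≈w+p : ∀ θ w p → θ + (p + (w - θ)) ≈ w + p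
  θ+[p+[w-θ]]≈w+p θ w p = begin-equality
    θ + (p + (w - θ)) ≈⟨ solve 3 (λ θ p x → θ :+ (p :+ x) := (x :+ θ) :+ p) refl θ p (w - θ) ⟩
    ((w - θ) + θ) + p ≈⟨ +-congʳ ([x-y]+y≈x w θ) ⟩
    w + p             ∎

  w+p≤θ+lift : ∀ θ w p → w + p ≤ θ + lift θ w p
  w+p≤θ+lift θ w p with w ≤? θ
  ... | yes w≤θ = +-monoˡ-≤ p w≤θ
  ... | no  _   = ≤-reflexive (sym (θ+[p+[w-θ]]≈w+p θ w p))

  -- With `p≤lift` and `w+p≤θ+lift` this characterises `lift` by inequalities alone, so `lift-mono`
  -- and `lift-swap` need no case split.
  lift-least : ∀ θ w p {b} → p ≤ b → w + p ≤ θ + b → lift θ w p ≤ b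
  lift-least θ w p p≤b w+p≤θ+b with w ≤? θ
  ... | yes _ = p≤b
  ... | no  _ = +-cancelˡ-≤ θ (≤-trans (≤-reflexive (θ+[p+[w-θ]]≈w+p θ w p)) w+p≤θ+b)

  lift-mono : ∀ {θ θ′} w {p p′} → θ ≤ θ′ → p ≤ p′ → lift θ′ w p ≤ lift θ w p′
  lift-mono {θ} {θ′} w {p} {p′} θ≤θ′ p≤p′ = lift-least θ′ w p
    (≤-trans p≤p′ (p≤lift θ w p′))
    (begin
      w + p              ≤⟨ +-monoʳ-≤ w p≤p′ ⟩
      w + p′             ≤⟨ w+p≤θ+lift θ w p′ ⟩
      θ  + lift θ w p′   ≤⟨ +-monoˡ-≤ _ θ≤θ′ ⟩
      θ′ + lift θ w p′   ∎)

  -- Both sides add the same two excesses to `p`. One inequality is enough, as `x` and `y` are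
  -- arbitrary.
  lift-swap : ∀ θ x y p → lift θ x (lift θ y p) ≤ lift θ y (lift θ x p)
  lift-swap θ x y p = lift-least θ x (lift θ y p)
    (lift-mono y ≤-refl (p≤lift θ x p))
    (begin
      x + lift θ y p ≤⟨ +-monoʳ-≤ x (lift-least θ y p p≤b y+p≤θ+b) ⟩
      x + b          ≈⟨ x+b≈θ+R ⟩
      θ + R          ∎)
    where
    R = lift θ y (lift θ x p)
    -- Solves `x + b ≈ θ + R`, so that the remaining goal `x + lift θ y p ≤ θ + R` becomes
    -- `lift θ y p ≤ b`, to which `lift-least` applies.
    b = (θ + R) - x

    x+b≈θ+R : x + b ≈ θ + R
    x+b≈θ+R = trans (+-comm x b) ([x-y]+y≈x (θ + R) x)

    p≤b : p ≤ b
    p≤b = +-cancelˡ-≤ x (begin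
      x + p          ≤⟨ w+p≤θ+lift θ x p ⟩
      θ + lift θ x p ≤⟨ +-monoʳ-≤ θ (p≤lift θ y _) ⟩
      θ + R          ≈⟨ x+b≈θ+R ⟨
      x + b          ∎)

    y+p≤θ+b : y + p ≤ θ + b
    y+p≤θ+b = +-cancelˡ-≤ x (begin
      x + (y + p)          ≈⟨ solve 3 (λ x y p → x :+ (y :+ p) := y :+ (x :+ p)) refl x y p ⟩
      y + (x + p)          ≤⟨ +-monoʳ-≤ y (w+p≤θ+lift θ x p) ⟩
      y + (θ + lift θ x p) ≈⟨ solve 3 (λ x y p → x :+ (y :+ p) := y :+ (x :+ p)) refl y θ _ ⟩
      θ + (y + lift θ x p) ≤⟨ +-monoʳ-≤ θ (w+p≤θ+lift θ y _) ⟩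
      θ + (θ + R)          ≈⟨ +-congˡ x+b≈θ+R ⟨
      θ + (x + b)          ≈⟨ solve 3 (λ x y p → x :+ (y :+ p) := y :+ (x :+ p)) refl θ x b ⟩
      x + (θ + b)          ∎)

  excess : Carrier → List Carrier → Carrier
  excess θ = foldr (lift θ) 0#

  excess-nonNeg : ∀ θ ws → 0# ≤ excess θ ws
  excess-nonNeg θ []       = ≤-refl
  excess-nonNeg θ (w ∷ ws) = ≤-trans (excess-nonNeg θ ws) (p≤lift θ w _)

  excess-antitone : ∀ {θ θ′} ws → θ ≤ θ′ → excess θ′ ws ≤ excess θ ws
  excess-antitone []       θ≤θ′ = ≤-refl
  excess-antitone (w ∷ ws) θ≤θ′ = lift-mono w θ≤θ′ (excess-antitone ws θ≤θ′)

  -- Connects the sorted list in `cost` with the traversal order in which the dynamic program meets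
  -- the distances.
  excess-resp-↭ : ∀ θ {vs ws} → vs ↭ ws → excess θ vs ≤ excess θ ws
  excess-resp-↭ θ ↭.refl           = ≤-refl
  excess-resp-↭ θ (prep w vs↭ws)   = lift-mono w ≤-refl (excess-resp-↭ θ vs↭ws)
  excess-resp-↭ θ (swap x y vs↭ws) =
    ≤-trans (lift-swap θ x y _) (lift-mono y ≤-refl (lift-mono x ≤-refl (excess-resp-↭ θ vs↭ws)))
  excess-resp-↭ θ (↭.trans p q)    = ≤-trans (excess-resp-↭ θ p) (excess-resp-↭ θ q)

  excess-zero : ∀ θ ws → All (_≤ θ) ws → excess θ ws ≤ 0#
  excess-zero θ []       []             = ≤-refl
  excess-zero θ (w ∷ ws) (w≤θ ∷ ws≤θ) = lift-least θ w (excess θ ws) ih (+-mono-≤ w≤θ ih)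
    where ih = excess-zero θ ws ws≤θ

  -- Expressed by `lift` so that it is the same fold as the path cost with threshold `λ p → p`.
  -- Starting from 0 is harmless for distances.
  maximum : List Carrier → Carrier
  maximum = foldr (λ w p → lift p w p) 0#

  w≤max : ∀ w p → w ≤ lift p w p
  w≤max w p = +-cancelʳ-≤ p (≤-trans (w+p≤θ+lift p w p) (≤-reflexive (+-comm p _)))

  max-least : ∀ {w p b} → w ≤ b → p ≤ b → lift p w p ≤ b
  max-least {w} {p} {b} w≤b p≤b =
    lift-least p w p p≤b (≤-trans (+-monoˡ-≤ p w≤b) (≤-reflexive (+-comm b p)))

  max-mono : ∀ w {p p′} → p ≤ p′ → lift p w p ≤ lift p′ w p′
  max-mono w {p′ = p′} p≤p′ = max-least (w≤max w p′) (≤-trans p≤p′ (p≤lift p′ w p′))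

  maximum-nonNeg : ∀ ws → 0# ≤ maximum ws
  maximum-nonNeg []       = ≤-refl
  maximum-nonNeg (w ∷ ws) = ≤-trans (maximum-nonNeg ws) (p≤lift _ w _)

  maximum-upper : ∀ ws → All (_≤ maximum ws) ws
  maximum-upper []       = []
  maximum-upper (w ∷ ws) = w≤max w _ ∷ All.map (λ v≤ → ≤-trans v≤ (p≤lift _ w _)) (maximum-upper ws)

  maximum-least : ∀ ws {b} → 0# ≤ b → All (_≤ b) ws → maximum ws ≤ b
  maximum-least []       0≤b []             = 0≤b
  maximum-least (w ∷ ws) 0≤b (w≤b ∷ ws≤b) = max-least w≤b (maximum-least ws 0≤b ws≤b)

  sumTake : ℕ → List Carrier → Carrier
  sumTake k ws = foldr _+_ 0# (take k ws)

  sumTake-nonNeg : ∀ k ws → All (0# ≤_) ws → 0# ≤ sumTake k ws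
  sumTake-nonNeg zero    ws       _            = ≤-refl
  sumTake-nonNeg (suc k) []       _            = ≤-refl
  sumTake-nonNeg (suc k) (w ∷ ws) (0≤w ∷ 0≤ws) = +-nonNeg 0≤w (sumTake-nonNeg k ws 0≤ws)

  sumTake≤k*bound : ∀ k ws {b} → 0# ≤ b → All (_≤ b) ws → sumTake k ws ≤ fromNat k * b
  sumTake≤k*bound zero    ws       {b} 0≤b _  = ≤-reflexive (sym (zeroˡ b))
  sumTake≤k*bound (suc k) []       0≤b _      = *-nonNeg (fromNat-nonNeg (suc k)) 0≤b
  sumTake≤k*bound (suc k) (w ∷ ws) {b} 0≤b (w≤b ∷ ws≤b) = begin
    w + sumTake k ws   ≤⟨ +-mono-≤ w≤b (sumTake≤k*bound k ws 0≤b ws≤b) ⟩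
    b + fromNat k * b  ≈⟨ solve 2 (λ b n → b :+ n :* b := (con 1 :+ n) :* b) refl b (fromNat k) ⟩
    fromNat (suc k) * b ∎

  -- Every entry taken is at most θ plus its own excess, and the entries left out contribute
  -- nonnegative excesses. If fewer than `k` entries exist, `0# ≤ θ` covers the missing ones.
  sumTake≤kθ+excess : ∀ k ws {θ} → 0# ≤ θ → sumTake k ws ≤ fromNat k * θ + excess θ ws
  sumTake≤kθ+excess zero    ws       {θ} 0≤θ =
    +-nonNeg (≤-reflexive (sym (zeroˡ θ))) (excess-nonNeg θ ws)
  sumTake≤kθ+excess (suc k) []       0≤θ =
    +-nonNeg (*-nonNeg (fromNat-nonNeg (suc k)) 0≤θ) ≤-refl
  sumTake≤kθ+excess (suc k) (w ∷ ws) {θ} 0≤θ = begin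
    w + sumTake k ws
      ≤⟨ +-monoʳ-≤ w (sumTake≤kθ+excess k ws 0≤θ) ⟩
    w + (K * θ + E)
      ≈⟨ solve 3 (λ x y z → x :+ (y :+ z) := y :+ (x :+ z)) refl w (K * θ) E ⟩
    K * θ + (w + E)
      ≤⟨ +-monoʳ-≤ (K * θ) (w+p≤θ+lift θ w E) ⟩
    K * θ + (θ + lift θ w E)
      ≈⟨ solve 3 (λ K θ x → K :* θ :+ (θ :+ x) := (con 1 :+ K) :* θ :+ x) refl K θ _ ⟩
    fromNat (suc k) * θ + excess θ (w ∷ ws) ∎
    where
    K = fromNat k
    E = excess θ ws

  -- The optimal threshold is the (suc k)-th entry, or 0# if there is none.
  optimalThreshold : ∀ k ws → AllPairs (flip _≤_) ws → All (0# ≤_) ws → ∃[ θ ]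
    0# ≤ θ × (∀ u → 0# ≤ u → All (_≤ u) ws → θ ≤ u)
           × fromNat (suc k) * θ + excess θ ws ≤ sumTake (suc k) ws
  optimalThreshold k [] _ _ =
    0# , ≤-refl , (λ _ 0≤u _ → 0≤u) , ≤-reflexive (trans (+-identityʳ _) (zeroʳ _))
  optimalThreshold zero (w ∷ ws) (ws≤w ∷ _) (0≤w ∷ _) =
    w , 0≤w , (λ { u _ (w≤u ∷ _) → w≤u })
      , +-mono-≤ (≤-reflexive (trans (*-congʳ (+-identityʳ 1#)) (*-identityˡ w)))
                 (excess-zero w (w ∷ ws) (≤-refl ∷ ws≤w))
  optimalThreshold (suc k) (w ∷ ws) (ws≤w ∷ sorted) (0≤w ∷ 0≤ws)
    with optimalThreshold k ws sorted 0≤ws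
  ... | θ , 0≤θ , θ≤ , optimal = θ , 0≤θ , (λ { u 0≤u (_ ∷ ws≤u) → θ≤ u 0≤u ws≤u }) , (begin
    (1# + K) * θ + lift θ w E
      -- The induction carries the comparison of θ with all upper bounds for this step: `w` is an
      -- upper bound of `ws`, hence `θ ≤ w`, and the excess of `w` is at most `w - θ`. The extra θ
      -- then completes it to `w`.
      ≤⟨ +-monoʳ-≤ _ (lift-least θ w E (x≤x+y (x≤y⇒0≤y-x (θ≤ w 0≤w ws≤w)))
           (≤-reflexive (sym (θ+[p+[w-θ]]≈w+p θ w E)))) ⟩
    (1# + K) * θ + (E + (w - θ))
      ≈⟨ solve 4 (λ K θ E x → (con 1 :+ K) :* θ :+ (E :+ x) := (x :+ θ) :+ (K :* θ :+ E))
           refl K θ E (w - θ) ⟩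
    ((w - θ) + θ) + (K * θ + E)
      ≤⟨ +-mono-≤ (≤-reflexive ([x-y]+y≈x w θ)) optimal ⟩
    w + sumTake (suc k) ws ∎)
    where
    K = fromNat (suc k)
    E = excess θ ws

  maximum≤sumTake : ∀ k ws → AllPairs (flip _≤_) ws → All (0# ≤_) ws → maximum ws ≤ sumTake (suc k) ws
  maximum≤sumTake k []       _          _            = ≤-refl
  maximum≤sumTake k (w ∷ ws) (ws≤w ∷ _) (0≤w ∷ 0≤ws) =
    ≤-trans (maximum-least (w ∷ ws) 0≤w (≤-refl ∷ ws≤w)) (x≤x+y (sumTake-nonNeg k ws 0≤ws))

-- Costs of traversals and the dynamic program.

lookup?-toℕ : ∀ {A : Set} {m} (f : Vector A m) i → lookup? f (toℕ i) ≡ just (f i)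
lookup?-toℕ {m = m} f i with toℕ i ℕ.<? m
... | yes i<m = ≡.cong (just ∘ f) (Fin.fromℕ<-toℕ i i<m)
... | no  i≮m = contradiction (Fin.toℕ<n i) i≮m

module Costs (ℝ : RealNumbers) {d n′ n″ : ℕ}
             (σ : KDTW.Curve ℝ d (suc n′)) (τ : KDTW.Curve ℝ d (suc n″)) where
  open RealNumbers ℝ
  open KDTW ℝ
  open Execution ℝ using (distance)
  open RealProperties ℝ
  open Thresholds ℝ

  distances : List (Index n′ n″) → List Carrier
  distances = map λ (i , j) → ‖ σ i - τ j ‖

  distances-nonNeg : ∀ T → All (0# ≤_) (distances T)
  distances-nonNeg T = All.map⁺ (All.universal
    (λ (i , j) → √-nonNeg (∑-nonNeg _ λ c → square-nonNeg (σ i c - τ j c))) T)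

  module _ (T : List (Index n′ n″)) where
    private
      O = Flip.decTotalOrder decTotalOrder
      sorted↭ = Sort.sort-↭ O (distances T)
      sorted  = Sorted⇒AllPairs (DecTotalOrder.totalOrder O) (Sort.sort-↗ O (distances T))
      nonNeg  = All-resp-↭ (↭-sym sorted↭) (distances-nonNeg T)

    cost≤kθ+excess : ∀ k {θ} → 0# ≤ θ → cost k σ τ T ≤ fromNat k * θ + excess θ (distances T)
    cost≤kθ+excess k {θ} 0≤θ =
      ≤-trans (sumTake≤kθ+excess k _ 0≤θ) (+-monoʳ-≤ _ (excess-resp-↭ θ sorted↭))

    cost≥kθ+excess : ∀ k → 1 ℕ.≤ k → ∃[ θ ] 0# ≤ θ ×
                     fromNat k * θ + excess θ (distances T) ≤ cost k σ τ T
    cost≥kθ+excess (suc k) _ with optimalThreshold k _ sorted nonNeg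
    ... | θ , 0≤θ , _ , optimal =
      θ , 0≤θ , ≤-trans (+-monoʳ-≤ _ (excess-resp-↭ θ (↭-sym sorted↭))) optimal

    maximum≤cost : ∀ k → 1 ℕ.≤ k → maximum (distances T) ≤ cost k σ τ T
    maximum≤cost (suc k) _ = ≤-trans
      (maximum-least (distances T) (maximum-nonNeg ws) (All-resp-↭ sorted↭ (maximum-upper ws)))
      (maximum≤sumTake k ws sorted nonNeg)
      where ws = sortNonIncreasing (distances T)

    cost≤k*maximum : ∀ k → cost k σ τ T ≤ fromNat k * maximum (distances T)
    cost≤k*maximum k = sumTake≤k*bound k _ (maximum-nonNeg (distances T))
      (All-resp-↭ (↭-sym sorted↭) (maximum-upper (distances T)))

  -- The test is oriented as in `choosePredecessor`, so the branches of the program reduce to it.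
  minimum : Carrier → Carrier → Carrier
  minimum x y = if does (y ≤? x) then y else x

  minimum-elim : ∀ (P : Carrier → Set) {x y} → P x → P y → P (minimum x y)
  minimum-elim P {x} {y} Px Py with y ≤? x
  ... | yes _ = Py
  ... | no  _ = Px

  minimum≤ˡ : ∀ x y → minimum x y ≤ x
  minimum≤ˡ x y with y ≤? x
  ... | yes y≤x = y≤x
  ... | no  _   = ≤-refl

  minimum≤ʳ : ∀ x y → minimum x y ≤ y
  minimum≤ʳ x y with y ≤? x
  ... | yes _   = ≤-refl
  ... | no  y≰x = ≰⇒≥ y≰x

  -- Table indices count from the end of the curves: toGo thr a b is the least cost of a path
  -- from (n′ - a , n″ - b) to (n′ , n″), where entering a pair at distance w
  -- turns a cost p into lift (thr p) w p.
  weight : ℕ → ℕ → Carrier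
  weight a b = distance σ τ (n′ ℕ.∸ a) (n″ ℕ.∸ b)

  distance-toℕ : ∀ i j → distance σ τ (toℕ i) (toℕ j) ≡ ‖ σ i - τ j ‖
  distance-toℕ i j rewrite lookup?-toℕ σ i | lookup?-toℕ τ j = ≡.refl

  -- The additive form keeps truncated subtraction out of the arguments about paths.
  At : Index n′ n″ → ℕ → ℕ → Set
  At (i , j) a b = toℕ i ℕ.+ a ≡ n′ × toℕ j ℕ.+ b ≡ n″

  weight-At : ∀ i j {a b} → At (i , j) a b → weight a b ≡ ‖ σ i - τ j ‖
  weight-At i j {a} {b} (p , q) = ≡.trans
    (≡.cong₂ (distance σ τ) (index≡ (toℕ i) a p) (index≡ (toℕ j) b q)) (distance-toℕ i j)
    where
    index≡ : ∀ i a {n} → i ℕ.+ a ≡ n → n ℕ.∸ a ≡ i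
    index≡ i a ≡.refl = ℕ.m+n∸n≡m i a

  module _ (thr : Carrier → Carrier) where

    enter : Carrier → Carrier → Carrier
    enter w p = lift (thr p) w p

    toGo : ℕ → ℕ → Carrier
    toGo zero    zero    = enter (weight 0 0) 0#
    toGo zero    (suc b) = enter (weight 0 (suc b)) (toGo zero b)
    toGo (suc a) zero    = enter (weight (suc a) 0) (toGo a zero)
    toGo (suc a) (suc b) = enter (weight (suc a) (suc b))
      (minimum (minimum (toGo a (suc b)) (toGo (suc a) b)) (toGo a b))

    -- By definition this is `maximum (distances T)` for `thr = λ p → p` and
    -- `excess θ (distances T)` for `thr = λ _ → θ`.
    pathCost : List (Index n′ n″) → Carrier
    pathCost T = foldr enter 0# (distances T)

    ToEnd : Index n′ n″ → List (Index n′ n″) → Set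
    ToEnd x T = Linked _↝_ (x ∷ T) × last (x ∷ T) ≡ just (fromℕ n′ , fromℕ n″)

    pathCost-∷ : ∀ x T {a b} → At x a b → pathCost (x ∷ T) ≡ enter (weight a b) (pathCost T)
    pathCost-∷ (i , j) T at = ≡.cong (λ w → enter w (pathCost T)) (≡.sym (weight-At i j at))

    module _ (enter-mono : ∀ w {p q} → p ≤ q → enter w p ≤ enter w q) where

      private
        extend : ∀ x T {a b} → At x a b → ∀ {p} → p ≤ pathCost T →
                 enter (weight a b) p ≤ pathCost (x ∷ T)
        extend x T at p≤ = ≤-trans (enter-mono _ p≤) (≤-reflexive′ (≡.sym (pathCost-∷ x T at)))
          where
          ≤-reflexive′ : ∀ {u v} → u ≡ v → u ≤ v
          ≤-reflexive′ ≡.refl = ≤-refl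

        step : ∀ {n m} {i i⁺ : Fin n} a → toℕ i⁺ ≡ suc (toℕ i) → toℕ i ℕ.+ suc a ≡ m → toℕ i⁺ ℕ.+ a ≡ m
        step {i = i} a e p = ≡.trans (≡.cong (ℕ._+ a) e) (≡.trans (≡.sym (ℕ.+-suc (toℕ i) a)) p)

        stay : ∀ {n m} {i i⁺ : Fin n} a → toℕ i⁺ ≡ toℕ i → toℕ i ℕ.+ a ≡ m → toℕ i⁺ ℕ.+ a ≡ m
        stay a e p = ≡.trans (≡.cong (ℕ._+ a) e) p

        atEnd : ∀ n a → toℕ (fromℕ n) ℕ.+ a ≡ n → a ≡ 0
        atEnd n a p = ℕ.+-cancelˡ-≡ n a 0
          (≡.trans (≡.cong (ℕ._+ a) (≡.sym (Fin.toℕ-fromℕ n))) (≡.trans p (≡.sym (ℕ.+-identityʳ n))))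

        noStep : ∀ {n} {i i⁺ : Fin (suc n)} → toℕ i⁺ ≡ suc (toℕ i) → ¬ (toℕ i ℕ.+ 0 ≡ n)
        noStep {n} {i} {i⁺} e p = ℕ.<-irrefl (≡.trans (≡.sym (ℕ.+-identityʳ _)) p)
          (ℕ.≤-trans (ℕ.≤-reflexive (≡.sym e)) (Fin.toℕ≤pred[n] i⁺))

      -- Induction along the path: each step leads to one of the cells over which `toGo` minimises,
      -- and `enter-mono` carries the inequality through the current pair. On the border `noStep`
      -- refutes the steps that would leave the curves.
      toGo≤pathCost : ∀ x T a b → At x a b → ToEnd x T → toGo a b ≤ pathCost (x ∷ T)
      toGo≤pathCost x [] a b (p , q) (_ , ≡.refl)
        with ≡.refl ← atEnd n′ a p | ≡.refl ← atEnd n″ b q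
        = extend x [] (p , q) ≤-refl
      toGo≤pathCost x (y ∷ T) zero b (p , q) (inj₁ (e , _) ∷ _ , _) = contradiction p (noStep e)
      toGo≤pathCost x (y ∷ T) (suc a) zero (p , q) (inj₁ (e , f) ∷ L , l) =
        extend x (y ∷ T) (p , q) (toGo≤pathCost y T a 0 (step a e p , stay 0 f q) (L , l))
      toGo≤pathCost x (y ∷ T) (suc a) (suc b) (p , q) (inj₁ (e , f) ∷ L , l) =
        extend x (y ∷ T) (p , q) (≤-trans (≤-trans (minimum≤ˡ _ _) (minimum≤ˡ _ _))
          (toGo≤pathCost y T a (suc b) (step a e p , stay (suc b) f q) (L , l)))
      toGo≤pathCost x (y ∷ T) a zero (p , q) (inj₂ (inj₁ (_ , f)) ∷ _ , _) = contradiction q (noStep f)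
      toGo≤pathCost x (y ∷ T) zero (suc b) (p , q) (inj₂ (inj₁ (e , f)) ∷ L , l) =
        extend x (y ∷ T) (p , q) (toGo≤pathCost y T 0 b (stay 0 e p , step b f q) (L , l))
      toGo≤pathCost x (y ∷ T) (suc a) (suc b) (p , q) (inj₂ (inj₁ (e , f)) ∷ L , l) =
        extend x (y ∷ T) (p , q) (≤-trans (≤-trans (minimum≤ˡ _ _) (minimum≤ʳ _ _))
          (toGo≤pathCost y T (suc a) b (stay (suc a) e p , step b f q) (L , l)))
      toGo≤pathCost x (y ∷ T) zero b (p , q) (inj₂ (inj₂ (e , _)) ∷ _ , _) = contradiction p (noStep e)
      toGo≤pathCost x (y ∷ T) (suc a) zero (p , q) (inj₂ (inj₂ (_ , f)) ∷ _ , _) = contradiction q (noStep f)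
      toGo≤pathCost x (y ∷ T) (suc a) (suc b) (p , q) (inj₂ (inj₂ (e , f)) ∷ L , l) =
        extend x (y ∷ T) (p , q) (≤-trans (minimum≤ʳ _ _)
          (toGo≤pathCost y T a b (step a e p , step b f q) (L , l)))

      toGo≤traversal : ∀ T → IsTraversal T → toGo n′ n″ ≤ pathCost T
      toGo≤traversal (_ ∷ T) (L , ≡.refl , l) = toGo≤pathCost _ T n′ n″ (≡.refl , ≡.refl) (L , l)

    private
      next : ∀ {n} (i : Fin (suc n)) a → toℕ i ℕ.+ suc a ≡ n →
             ∃[ i⁺ ] toℕ i⁺ ≡ suc (toℕ i) × toℕ {suc n} i⁺ ℕ.+ a ≡ n
      next {n} i a p = fromℕ< i<n , Fin.toℕ-fromℕ< i<n
        , ≡.trans (≡.cong (ℕ._+ a) (Fin.toℕ-fromℕ< i<n)) si+a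
        where
        si+a = ≡.trans (≡.sym (ℕ.+-suc (toℕ i) a)) p
        i<n : suc (toℕ i) ℕ.< suc n
        i<n = s≤s (≡.subst (suc (toℕ i) ℕ.≤_) si+a (ℕ.m≤m+n (suc (toℕ i)) a))

      isEnd : ∀ {n} (i : Fin (suc n)) → toℕ i ℕ.+ 0 ≡ n → i ≡ fromℕ n
      isEnd {n} i p = Fin.toℕ-injective
        (≡.trans (≡.sym (ℕ.+-identityʳ (toℕ i))) (≡.trans p (≡.sym (Fin.toℕ-fromℕ n))))

      Attained : Index n′ n″ → Carrier → Set
      Attained x c = ∃[ T ] ToEnd x T × pathCost (x ∷ T) ≡ c

      prepend : ∀ {x y a b p} → At x a b → x ↝ y → Attained y p → Attained x (enter (weight a b) p)
      prepend {x} {y} at x↝y (T , (L , l) , ≡.refl) = y ∷ T , (x↝y ∷ L , l) , pathCost-∷ x (y ∷ T) at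

    -- The recursion itself builds an optimal path; `minimum-elim` follows the cell that was
    -- selected without naming it.
    attained : ∀ x a b → At x a b → Attained x (toGo a b)
    attained x zero zero (p , q) with ≡.refl ← isEnd (proj₁ x) p | ≡.refl ← isEnd (proj₂ x) q =
      [] , ([-] , ≡.refl) , pathCost-∷ x [] (p , q)
    attained (i , j) zero (suc b) (p , q) with next j b q
    ... | j⁺ , f , q⁺ = prepend (p , q) (inj₂ (inj₁ (≡.refl , f))) (attained (i , j⁺) 0 b (p , q⁺))
    attained (i , j) (suc a) zero (p , q) with next i a p
    ... | i⁺ , e , p⁺ = prepend (p , q) (inj₁ (e , ≡.refl)) (attained (i⁺ , j) a 0 (p⁺ , q))
    attained (i , j) (suc a) (suc b) (p , q) =
      let (i⁺ , e , p⁺) = next i a p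
          (j⁺ , f , q⁺) = next j b q
          P = λ m → Attained (i , j) (enter (weight (suc a) (suc b)) m)
      in minimum-elim P
           (minimum-elim P
             (prepend (p , q) (inj₁ (e , ≡.refl)) (attained (i⁺ , j) a (suc b) (p⁺ , q)))
             (prepend (p , q) (inj₂ (inj₁ (≡.refl , f))) (attained (i , j⁺) (suc a) b (p , q⁺))))
           (prepend (p , q) (inj₂ (inj₂ (e , f))) (attained (i⁺ , j⁺) a b (p⁺ , q⁺)))

    traversal-attains : ∃[ T ] IsTraversal T × pathCost T ≡ toGo n′ n″
    traversal-attains with attained (zero , zero) n′ n″ (≡.refl , ≡.refl)
    ... | T , (L , l) , e = _ ∷ T , (L , ≡.refl , l) , e

-- Number of thresholds in the geometric grid.

module Grid (ℝ : RealNumbers) where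
  open RealNumbers ℝ
  open RealProperties ℝ
  open MaxOp (Max.maxOperator totalOrder) public using (x≤x⊔y; x≤y⊔x)

  -- The factor `fromNat 1 + ε` and its position on the right are those of the assignment in
  -- `refine`, so the stored threshold equals a grid point propositionally.
  grid : Carrier → Carrier → ℕ → Carrier
  grid θ₀ ε zero    = θ₀
  grid θ₀ ε (suc i) = grid θ₀ ε i * (fromNat 1 + ε)

  grid≈ : ∀ θ₀ ε i → grid θ₀ ε i ≈ θ₀ * (1# + ε) ^ i
  grid≈ θ₀ ε zero    = sym (*-identityʳ θ₀)
  grid≈ θ₀ ε (suc i) = begin-equality
    grid θ₀ ε i * (fromNat 1 + ε)     ≈⟨ *-cong (grid≈ θ₀ ε i) (+-congʳ (+-identityʳ 1#)) ⟩
    θ₀ * (1# + ε) ^ i * (1# + ε)      ≈⟨ solve 3 (λ x y z → x :* y :* z := x :* (z :* y)) refl θ₀ _ _ ⟩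
    θ₀ * ((1# + ε) * (1# + ε) ^ i)    ∎

  module _ {ε : Carrier} (0<ε : 0# < ε) (ε≤1 : ε ≤ 1#) where

    1≤ε⁻¹ : 1# ≤ ε ⁻¹
    1≤ε⁻¹ = begin
      1#        ≈⟨ 0<⇒*-inverseʳ 0<ε ⟨
      ε * ε ⁻¹  ≤⟨ *-monoˡ-≤ (⁻¹-nonNeg 0<ε) ε≤1 ⟩
      1# * ε ⁻¹ ≈⟨ *-identityˡ _ ⟩
      ε ⁻¹      ∎

    -- For the least `m` with `ε ⁻¹ ≤ m` the product `m * ε` is at least 1, and Bernoulli's
    -- inequality applies. Minimality gives `m - 1 ≤ ε ⁻¹`, and the remaining 1 is at most `ε ⁻¹`
    -- because `ε ≤ 1#`.
    doublingTime : ∃[ m ] fromNat 2 ≤ (1# + ε) ^ m × fromNat m ≤ ε ⁻¹ + ε ⁻¹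
    doublingTime with archimedean (ε ⁻¹)
    ... | n , ε⁻¹≤n with least (λ m → ε ⁻¹ ≤ fromNat m) (λ m → ε ⁻¹ ≤? fromNat m) n ε⁻¹≤n
    ... | m , _ , ε⁻¹≤m , below = m , doubled , short m below
      where
      doubled : fromNat 2 ≤ (1# + ε) ^ m
      doubled = begin
        1# + fromNat 1     ≈⟨ +-congˡ (+-identityʳ 1#) ⟩
        1# + 1#            ≈⟨ +-congˡ (trans (*-comm (ε ⁻¹) ε) (0<⇒*-inverseʳ 0<ε)) ⟨
        1# + ε ⁻¹ * ε      ≤⟨ +-monoʳ-≤ 1# (*-monoˡ-≤ (proj₁ 0<ε) ε⁻¹≤m) ⟩
        1# + fromNat m * ε ≤⟨ bernoulli (proj₁ 0<ε) m ⟩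
        (1# + ε) ^ m       ∎

      short : ∀ m → (∀ i → i ℕ.< m → ¬ ε ⁻¹ ≤ fromNat i) → fromNat m ≤ ε ⁻¹ + ε ⁻¹
      short zero    _     = +-nonNeg (⁻¹-nonNeg 0<ε) (⁻¹-nonNeg 0<ε)
      short (suc i) below = +-mono-≤ 1≤ε⁻¹ (≰⇒≥ (below i ℕ.≤-refl))

    module _ (x : Carrier) where
      private
        -- For `x = 1` the logarithm vanishes although two tables are still filled; the maximum with
        -- 1 pays for them and for rounding up.
        L = 1# ⊔ log₂ x

        1≤L : 1# ≤ L
        1≤L = x≤x⊔y 1# (log₂ x)

      -- The predecessor of the least exponent is at most `log₂ x`, and the step up to it costs 1.
      powerOf2Above : ∃[ a ] x ≤ fromNat 2 ^ a × fromNat a ≤ L + L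
      powerOf2Above with archimedean x
      ... | n , x≤n with least (λ a → x ≤ fromNat 2 ^ a) (λ a → x ≤? fromNat 2 ^ a) n
                           (≤-trans x≤n (fromNat≤2^ n))
      ... | a , _ , x≤2^a , below = a , x≤2^a , short a below
        where
        short : ∀ a → (∀ i → i ℕ.< a → ¬ x ≤ fromNat 2 ^ i) → fromNat a ≤ L + L
        short zero    _     = +-nonNeg (≤-trans 0≤1 1≤L) (≤-trans 0≤1 1≤L)
        short (suc i) below = +-mono-≤ 1≤L
          (≤-trans (2^a≤x⇒a≤log₂x i (≰⇒≥ (below i ℕ.≤-refl))) (x≤y⊔x 1# (log₂ x)))

      -- After `m * a` factors the grid has grown by `2 ^ a`, at least `x`. With `m ≤ 2/ε` and
      -- `a ≤ 2L` this gives `N ≤ 4L/ε`; the two tables filled before the search raise 4 to 6. The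
      -- product form of the hypothesis on `F` admits `F = 0`.
      gridSize : ∀ {F θ₀} → 0# ≤ θ₀ → F ≈ θ₀ * x → ∃[ N ]
        F ≤ grid θ₀ ε N × (∀ i → i ℕ.< N → ¬ F ≤ grid θ₀ ε i)
                        × fromNat (2 ℕ.+ N) ≤ fromNat 6 * (L / ε)
      gridSize {F} {θ₀} 0≤θ₀ F≈θ₀x with doublingTime | powerOf2Above
      ... | m , doubled , m≤ | a , x≤2^a , a≤
        with least (λ i → F ≤ grid θ₀ ε i) (λ i → F ≤? grid θ₀ ε i) (m ℕ.* a) (begin
          F                            ≈⟨ F≈θ₀x ⟩
          θ₀ * x                       ≤⟨ *-monoʳ-≤ 0≤θ₀ x≤2^a ⟩
          θ₀ * fromNat 2 ^ a           ≤⟨ *-monoʳ-≤ 0≤θ₀ (^-monoˡ-≤ a (fromNat-nonNeg 2) doubled) ⟩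
          θ₀ * ((1# + ε) ^ m) ^ a      ≈⟨ *-congˡ (^-assocʳ (1# + ε) m a) ⟩
          θ₀ * (1# + ε) ^ (m ℕ.* a)    ≈⟨ grid≈ θ₀ ε (m ℕ.* a) ⟨
          grid θ₀ ε (m ℕ.* a)          ∎)
      ... | N , N≤ , F≤ , below = N , F≤ , below , (begin
        1# + (1# + fromNat N)
          ≤⟨ +-mono-≤ 1≤L/ε (+-mono-≤ 1≤L/ε N≤4L/ε) ⟩
        L * ε ⁻¹ + (L * ε ⁻¹ + (ε ⁻¹ + ε ⁻¹) * (L + L))
          ≈⟨ solve 2 (λ l z → l :* z :+ (l :* z :+ (z :+ z) :* (l :+ l))
               := (con 1 :+ (con 1 :+ (con 1 :+ (con 1 :+ (con 1 :+ (con 1 :+ con 0)))))) :* (l :* z))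
               refl L (ε ⁻¹) ⟩
        fromNat 6 * (L / ε) ∎)
        where
        1≤L/ε : 1# ≤ L / ε
        1≤L/ε = begin
          1#        ≤⟨ 1≤L ⟩
          L         ≈⟨ *-identityʳ L ⟨
          L * 1#    ≤⟨ *-monoʳ-≤ (≤-trans 0≤1 1≤L) 1≤ε⁻¹ ⟩
          L * ε ⁻¹  ∎

        N≤4L/ε : fromNat N ≤ (ε ⁻¹ + ε ⁻¹) * (L + L)
        N≤4L/ε = begin
          fromNat N             ≤⟨ fromNat-mono N≤ ⟩
          fromNat (m ℕ.* a)     ≈⟨ ×1-homo-* m a ⟩
          fromNat m * fromNat a
            ≤⟨ *-mono-≤ (+-nonNeg (⁻¹-nonNeg 0<ε) (⁻¹-nonNeg 0<ε)) (fromNat-nonNeg a) m≤ a≤ ⟩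
          (ε ⁻¹ + ε ⁻¹) * (L + L) ∎

-- Approximation guarantee of the grid.

module Approximation (ℝ : RealNumbers) {d n′ n″ : ℕ}
    (σ : KDTW.Curve ℝ d (suc n′)) (τ : KDTW.Curve ℝ d (suc n″)) (k : ℕ) (1≤k : 1 ℕ.≤ k) where
  open RealNumbers ℝ
  open KDTW ℝ
  open RealProperties ℝ
  open Thresholds ℝ
  open Costs ℝ σ τ
  open Grid ℝ

  private
    K   = fromNat k
    OPT = kDTW k σ τ
    0<K = 0<fromNat 1≤k

    ≡⇒≤ : ∀ {x y} → x ≡ y → x ≤ y
    ≡⇒≤ ≡.refl = ≤-refl

  fréchet : Carrier
  fréchet = toGo (λ p → p) n′ n″

  value : Carrier → Carrier
  value θ = K * θ + toGo (λ _ → θ) n′ n″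

  fréchet-nonNeg : 0# ≤ fréchet
  fréchet-nonNeg with traversal-attains (λ p → p)
  ... | T , _ , eq = ≤-trans (maximum-nonNeg (distances T)) (≡⇒≤ eq)

  fréchet≤cost : ∀ T → IsTraversal T → fréchet ≤ cost k σ τ T
  fréchet≤cost T t = ≤-trans (toGo≤traversal (λ p → p) max-mono T t) (maximum≤cost T k 1≤k)

  fréchet≤kDTW : fréchet ≤ OPT
  fréchet≤kDTW = let (T , t , eq) = kDTW-attained k σ τ in
    ≤-trans (fréchet≤cost T t) (≡⇒≤ (≡.sym eq))

  kDTW≤k*fréchet : OPT ≤ K * fréchet
  kDTW≤k*fréchet = let (T , t , eq) = traversal-attains (λ p → p) in begin
    OPT                       ≤⟨ kDTW-minimal k σ τ T t ⟩
    cost k σ τ T              ≤⟨ cost≤k*maximum T k ⟩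
    K * maximum (distances T) ≤⟨ *-monoʳ-≤ (proj₁ 0<K) (≡⇒≤ eq) ⟩
    K * fréchet               ∎

  kDTW≤value : ∀ {θ} → 0# ≤ θ → OPT ≤ value θ
  kDTW≤value {θ} 0≤θ = let (T , t , eq) = traversal-attains (λ _ → θ) in begin
    OPT                          ≤⟨ kDTW-minimal k σ τ T t ⟩
    cost k σ τ T                 ≤⟨ cost≤kθ+excess T k 0≤θ ⟩
    K * θ + excess θ (distances T) ≤⟨ +-monoʳ-≤ (K * θ) (≡⇒≤ eq) ⟩
    value θ                      ∎

  module _ {ε : Carrier} (0≤ε : 0# ≤ ε) where

    θ₀ : Carrier
    θ₀ = ε * fréchet / K

    θ₀-nonNeg : 0# ≤ θ₀
    θ₀-nonNeg = *-nonNeg (*-nonNeg 0≤ε fréchet-nonNeg) (⁻¹-nonNeg 0<K)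

    grid-nonNeg : ∀ i → 0# ≤ grid θ₀ ε i
    grid-nonNeg zero    = θ₀-nonNeg
    grid-nonNeg (suc i) = *-nonNeg (grid-nonNeg i) (+-nonNeg (fromNat-nonNeg 1) 0≤ε)

    module _ {T θ} (t : IsTraversal T) (0≤θ : 0# ≤ θ)
             (optimal : K * θ + excess θ (distances T) ≤ cost k σ τ T) where
      private
        c = cost k σ τ T
        E = excess θ (distances T)

      -- The traversal chosen for θ is kept while the threshold rises to ϑ.
      value≤ : ∀ {ϑ} → θ ≤ ϑ → value ϑ ≤ K * ϑ + E
      value≤ {ϑ} θ≤ϑ = +-monoʳ-≤ (K * ϑ) (≤-trans
        (toGo≤traversal (λ _ → ϑ) (λ w → lift-mono w ≤-refl) T t)
        (excess-antitone (distances T) θ≤ϑ))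

      E≤c : E ≤ c
      E≤c = ≤-trans (x≤x+y (*-nonNeg (proj₁ 0<K) 0≤θ)) (≤-trans (≤-reflexive (+-comm E (K * θ))) optimal)

      -- The first grid point above θ exceeds it by a factor of at most 1 + ε, unless
      -- it is θ₀, whose contribution is K * θ₀ = ε * fréchet.
      firstAbove-approximates : ∀ i → θ ≤ grid θ₀ ε i → (∀ j → j ℕ.< i → ¬ θ ≤ grid θ₀ ε j) →
              value (grid θ₀ ε i) ≤ (1# + ε) * c
      firstAbove-approximates zero θ≤ _ = begin
        value θ₀        ≤⟨ value≤ θ≤ ⟩
        K * θ₀ + E      ≈⟨ +-congʳ (y*[x/y]≈x (ε * fréchet) 0<K) ⟩
        ε * fréchet + E ≤⟨ +-mono-≤ (*-monoʳ-≤ 0≤ε (fréchet≤cost T t)) E≤c ⟩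
        ε * c + c       ≈⟨ solve 2 (λ e o → e :* o :+ o := (con 1 :+ e) :* o) refl ε c ⟩
        (1# + ε) * c    ∎
      firstAbove-approximates (suc i) θ≤ below = begin
        value (grid θ₀ ε (suc i))
          ≤⟨ value≤ θ≤ ⟩
        K * (grid θ₀ ε i * (fromNat 1 + ε)) + E
          ≤⟨ +-mono-≤
               (*-monoʳ-≤ (proj₁ 0<K) (*-monoˡ-≤ (+-nonNeg (fromNat-nonNeg 1) 0≤ε) (≰⇒≥ (below i ℕ.≤-refl))))
               (x≤x+y (*-nonNeg 0≤ε (excess-nonNeg θ (distances T)))) ⟩
        K * (θ * (fromNat 1 + ε)) + (E + ε * E)
          ≈⟨ solve 4 (λ n t e x → n :* (t :* ((con 1 :+ con 0) :+ e)) :+ (x :+ e :* x)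
                               := (con 1 :+ e) :* (n :* t :+ x)) refl K θ ε E ⟩
        (1# + ε) * (K * θ + E)
          ≤⟨ *-monoʳ-≤ (+-nonNeg 0≤1 0≤ε) optimal ⟩
        (1# + ε) * c ∎

    grid-approximates : ∀ N → fréchet ≤ grid θ₀ ε N →
                        ∃[ i ] i ℕ.≤ N × value (grid θ₀ ε i) ≤ (1# + ε) * OPT
    grid-approximates N F≤ =
      let (T , t , eq)           = kDTW-attained k σ τ
          cost≤OPT               = ≡⇒≤ (≡.sym eq)
          (θ , 0≤θ , optimal)    = cost≥kθ+excess T k 1≤k
          -- The excess is dropped: `K * θ` is at most `OPT`, hence at most `K * fréchet`, and `K`
          -- cancels. So grid point `N` lies above θ.
          θ≤F                    = *-cancelˡ-≤ 0<K (≤-trans (x≤x+y (excess-nonNeg θ (distances T)))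
                                     (≤-trans optimal (≤-trans cost≤OPT kDTW≤k*fréchet)))
          (i , i≤N , θ≤ , below) = least (λ i → θ ≤ grid θ₀ ε i) (λ i → θ ≤? grid θ₀ ε i) N (≤-trans θ≤F F≤)
      in i , i≤N , ≤-trans (firstAbove-approximates t 0≤θ optimal i θ≤ below)
                           (*-monoʳ-≤ (+-nonNeg 0≤1 0≤ε) cost≤OPT)

  -- The range that the grid must cover has ratio `K / ε`, which thereby becomes the argument of the
  -- logarithm.
  fréchet≈θ₀*[k/ε] : ∀ {ε} (0<ε : 0# < ε) → fréchet ≈ θ₀ (proj₁ 0<ε) * (K / ε)
  fréchet≈θ₀*[k/ε] {ε} 0<ε = begin-equality
    fréchet                                 ≈⟨ *-identityʳ fréchet ⟨
    fréchet * 1#                            ≈⟨ *-congˡ (*-identityʳ 1#) ⟨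
    fréchet * (1# * 1#)                     ≈⟨ *-congˡ (*-cong (0<⇒*-inverseʳ 0<ε) (0<⇒*-inverseʳ 0<K)) ⟨
    fréchet * ((ε * ε ⁻¹) * (K * K ⁻¹))
      ≈⟨ solve 5 (λ f e e′ n n′ → f :* ((e :* e′) :* (n :* n′)) := (e :* f :* n′) :* (n :* e′)) refl
           fréchet ε (ε ⁻¹) K (K ⁻¹) ⟩
    θ₀ (proj₁ 0<ε) * (K / ε)                ∎

-- The program.

-- Registers 4 and 5 hold the current row and column of the table.  Array 1 holds one
-- row of it, and cell 0 of the arrays 2 to 6 the diagonal predecessor, the best
-- predecessor, the largest threshold, the current threshold and the best value.

row : IntExp → RealExp
row = 1 [_]

diagonal predecessor largest threshold best accuracy : RealExp
accuracy    = 0 [ lit 0 ]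
diagonal    = 2 [ lit 0 ]
predecessor = 3 [ lit 0 ]
largest     = 4 [ lit 0 ]
threshold   = 5 [ lit 0 ]
best        = 6 [ lit 0 ]

left : IntExp
left = reg 5 ⊖ lit 1

-- Registers 0 and 1 hold lengths, hence the `lit 1`; subtracting row and column undoes the counting
-- from the end.
distanceHere : RealExp
distanceHere = dist (reg 0 ⊖ lit 1 ⊖ reg 4) (reg 1 ⊖ lit 1 ⊖ reg 5)

-- `row left` already belongs to the current row, `row (reg 5)` still to the one before, and
-- `diagonal` keeps the entry overwritten one column earlier. The first cell of the table starts
-- from cost 0.
choosePredecessor : Program
choosePredecessor =
  IF reg 4 ≤ᵢ lit 0
  THEN (IF reg 5 ≤ᵢ lit 0
        THEN 3 [ lit 0 ]≔ cast (lit 0)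
        ELSE 3 [ lit 0 ]≔ row left)
  ELSE (IF reg 5 ≤ᵢ lit 0
        THEN 3 [ lit 0 ]≔ row (reg 5)
        ELSE (IF row left ≤ᵣ row (reg 5)
              THEN (IF diagonal ≤ᵣ row left
                    THEN 3 [ lit 0 ]≔ diagonal
                    ELSE 3 [ lit 0 ]≔ row left)
              ELSE (IF diagonal ≤ᵣ row (reg 5)
                    THEN 3 [ lit 0 ]≔ diagonal
                    ELSE 3 [ lit 0 ]≔ row (reg 5))))

-- With `e = predecessor` the cell receives a maximum, with `e = threshold` an accumulated excess.
enterCell : RealExp → Program
enterCell e =
  IF distanceHere ≤ᵣ e
  THEN 1 [ reg 5 ]≔ predecessor
  ELSE 1 [ reg 5 ]≔ predecessor ⊞ (distanceHere ⊟ e)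

-- `diagonal` is replaced after the choice has read it and before `enterCell` overwrites the entry
-- that the next column needs.
cell : RealExp → Program
cell e =
  choosePredecessor ⨾ 2 [ lit 0 ]≔ row (reg 5) ⨾ enterCell e ⨾ 5 ≔ lit 1 ⊕ reg 5

fillRow : RealExp → Program
fillRow e = WHILE neg (reg 1 ≤ᵢ reg 5) DO cell e

fillTable : RealExp → Program
fillTable e =
  4 ≔ lit 0 ⨾
  WHILE neg (reg 0 ≤ᵢ reg 4) DO (5 ≔ lit 0 ⨾ fillRow e ⨾ 4 ≔ lit 1 ⊕ reg 4)

lastCell valueHere : RealExp
lastCell  = row (reg 1 ⊖ lit 1)
valueHere = cast (reg 2) ⊠ threshold ⊞ lastCell

improve : Program
improve = IF best ≤ᵣ valueHere THEN SKIP ELSE 6 [ lit 0 ]≔ valueHere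

refine : Program
refine =
  5 [ lit 0 ]≔ threshold ⊠ (cast (lit 1) ⊞ accuracy) ⨾ fillTable threshold ⨾ improve

algorithm : Program
algorithm =
  fillTable predecessor ⨾
  4 [ lit 0 ]≔ lastCell ⨾
  5 [ lit 0 ]≔ accuracy ⊠ largest ⊘ cast (reg 2) ⨾
  fillTable threshold ⨾
  6 [ lit 0 ]≔ valueHere ⨾
  (WHILE neg (largest ≤ᵣ threshold) DO refine) ⨾
  0 [ lit 0 ]≔ best

-- An upper bound for the running time of loop-free programs only.
steps : Program → ℕ
steps SKIP                   = 1
steps (x ≔ e)                = suc (sizeᵢ e)
steps (a [ e ]≔ r)           = suc (sizeᵢ e ℕ.+ sizeᵣ r)
steps (P ⨾ Q)                = steps P ℕ.+ steps Q
steps (IF b THEN P ELSE Q)   = suc (sizeₜ b ℕ.+ (steps P ℕ.+ steps Q))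
steps (WHILE b DO P)         = suc (sizeₜ b)

-- The 5 is the cost of a loop test. The 9 and 14 are the initialisations, loop tests and row
-- increment around the cells, charged to every cell by `absorb₂`.
cellTime tableTime : RealExp → ℕ
cellTime e  = 5 ℕ.+ steps (cell e)
tableTime e = 9 ℕ.+ cellTime e ℕ.+ 14

-- The 100 is a round bound: outside its table a pass of the search takes at most 44 steps, and the
-- rest of the program at most 39.
perCellTime : ℕ
perCellTime = tableTime threshold ℕ.+ 100

-- A loop with `suc n` passes runs at least once, so costs outside it may be paid again in every
-- pass.
absorb : ∀ n c k l → k ℕ.+ (suc n ℕ.* c ℕ.+ l) ℕ.≤ suc n ℕ.* (k ℕ.+ c ℕ.+ l)
absorb n c k l = begin
  k ℕ.+ (suc n ℕ.* c ℕ.+ l)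
    ≤⟨ ℕ.+-mono-≤ (ℕ.m≤m+n k (n ℕ.* k)) (ℕ.+-monoʳ-≤ (suc n ℕ.* c) (ℕ.m≤m+n l (n ℕ.* l))) ⟩
  suc n ℕ.* k ℕ.+ (suc n ℕ.* c ℕ.+ suc n ℕ.* l) ≡⟨ ℕ.+-assoc (suc n ℕ.* k) (suc n ℕ.* c) (suc n ℕ.* l) ⟨
  suc n ℕ.* k ℕ.+ suc n ℕ.* c ℕ.+ suc n ℕ.* l   ≡⟨ ≡.cong (ℕ._+ suc n ℕ.* l) (ℕ.*-distribˡ-+ (suc n) k c) ⟨
  suc n ℕ.* (k ℕ.+ c) ℕ.+ suc n ℕ.* l           ≡⟨ ℕ.*-distribˡ-+ (suc n) (k ℕ.+ c) l ⟨
  suc n ℕ.* (k ℕ.+ c ℕ.+ l)                     ∎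
  where open ℕ.≤-Reasoning

absorb₂ : ∀ n′ n″ c → 2 ℕ.+ (suc n′ ℕ.* (5 ℕ.+ (2 ℕ.+ (suc n″ ℕ.* c ℕ.+ 5 ℕ.+ 4))) ℕ.+ 5)
                      ℕ.≤ suc n′ ℕ.* (suc n″ ℕ.* (9 ℕ.+ c ℕ.+ 14))
absorb₂ n′ n″ c = begin
  2 ℕ.+ (suc n′ ℕ.* (7 ℕ.+ (L ℕ.+ 5 ℕ.+ 4)) ℕ.+ 5) ≤⟨ absorb n′ (7 ℕ.+ (L ℕ.+ 5 ℕ.+ 4)) 2 5 ⟩
  suc n′ ℕ.* (9 ℕ.+ (L ℕ.+ 5 ℕ.+ 4) ℕ.+ 5)         ≡⟨ ≡.cong (suc n′ ℕ.*_) (collect L) ⟩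
  suc n′ ℕ.* (9 ℕ.+ (L ℕ.+ 14))                    ≤⟨ ℕ.*-monoʳ-≤ (suc n′) (absorb n″ c 9 14) ⟩
  suc n′ ℕ.* (suc n″ ℕ.* (9 ℕ.+ c ℕ.+ 14))         ∎
  where
  open ℕ.≤-Reasoning
  L = suc n″ ℕ.* c

  collect : ∀ x → 9 ℕ.+ (x ℕ.+ 5 ℕ.+ 4) ℕ.+ 5 ≡ 9 ℕ.+ (x ℕ.+ 14)
  collect = solve-∀

-- A program logic for total correctness with time bounds.

module Hoare (ℝ : RealNumbers) {d m′ m″ : ℕ}
             (σ : KDTW.Curve ℝ d m′) (τ : KDTW.Curve ℝ d m″) where
  open RealNumbers ℝ using (Carrier)
  open Execution ℝ

  -- The time is bounded rather than exact, so that both branches of a conditional satisfy the same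
  -- judgement.
  Exec : Program → State → (State → Set) → ℕ → Set
  Exec P s Q c = ∃[ s′ ] ∃[ t ] Run σ τ P s s′ t × Q s′ × t ℕ.≤ c

  private variable
    P P₁ P₂ : Program
    Q R : State → Set
    s : State
    c c₁ c₂ : ℕ

  exec-weaken : c₁ ℕ.≤ c₂ → Exec P s Q c₁ → Exec P s Q c₂
  exec-weaken c₁≤c₂ (s′ , t , r , q , t≤c) = s′ , t , r , q , ℕ.≤-trans t≤c c₁≤c₂

  exec-map : (∀ {s′} → Q s′ → R s′) → Exec P s Q c → Exec P s R c
  exec-map f (s′ , t , r , q , t≤c) = s′ , t , r , f q , t≤c

  exec-skip : Q s → Exec SKIP s Q 1
  exec-skip q = _ , _ , skip , q , ℕ.≤-refl

  exec-int : ∀ {x e} → Q (setInt x (evalᵢ σ τ e s) s) → Exec (x ≔ e) s Q (suc (sizeᵢ e))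
  exec-int q = _ , _ , assignInt , q , ℕ.≤-refl

  exec-real : ∀ {a e r} → Q (setReal a (evalᵢ σ τ e s) (evalᵣ σ τ r s) s) →
              Exec (a [ e ]≔ r) s Q (suc (sizeᵢ e ℕ.+ sizeᵣ r))
  exec-real q = _ , _ , assignReal , q , ℕ.≤-refl

  exec-seq : Exec P₁ s R c₁ → (∀ {s′} → R s′ → Exec P₂ s′ Q c₂) → Exec (P₁ ⨾ P₂) s Q (c₁ ℕ.+ c₂)
  exec-seq (_ , _ , r₁ , q₁ , t₁≤c₁) f with f q₁
  ... | _ , _ , r₂ , q₂ , t₂≤c₂ = _ , _ , seq r₁ r₂ , q₂ , ℕ.+-mono-≤ t₁≤c₁ t₂≤c₂

  exec-if : ∀ b → (evalₜ σ τ b s ≡ true → Exec P₁ s Q (steps P₁)) →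
            (evalₜ σ τ b s ≡ false → Exec P₂ s Q (steps P₂)) →
            Exec (IF b THEN P₁ ELSE P₂) s Q (steps (IF b THEN P₁ ELSE P₂))
  exec-if {s = s} {P₁ = P₁} {P₂ = P₂} b f g with evalₜ σ τ b s in eq
  ... | true  = let (_ , _ , r , q , t≤) = f ≡.refl in
    _ , _ , ifTrue eq r , q , s≤s (ℕ.+-monoʳ-≤ (sizeₜ b) (ℕ.≤-trans t≤ (ℕ.m≤m+n (steps P₁) (steps P₂))))
  ... | false = let (_ , _ , r , q , t≤) = g ≡.refl in
    _ , _ , ifFalse eq r , q , s≤s (ℕ.+-monoʳ-≤ (sizeₜ b) (ℕ.≤-trans t≤ (ℕ.m≤n+m (steps P₂) (steps P₁))))

  -- `J i` is the invariant after `i` passes. Fixing the number of passes in advance yields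
  -- termination and the time bound together.
  exec-while : ∀ {b} N (J : ℕ → State → Set) →
    (∀ i {s} → i ℕ.< N → J i s → evalₜ σ τ b s ≡ true × Exec P s (J (suc i)) c) →
    (∀ {s} → J N s → evalₜ σ τ b s ≡ false) →
    ∀ {s} → J 0 s →
    Exec (WHILE b DO P) s (J N) (N ℕ.* (suc (sizeₜ b) ℕ.+ c) ℕ.+ suc (sizeₜ b))
  exec-while {P} {c} {b} N J body exit = from N 0 ≡.refl
    where
    open ℕ.≤-Reasoning
    B = sizeₜ b

    from : ∀ n i {s} → i ℕ.+ n ≡ N → J i s →
           Exec (WHILE b DO P) s (J N) (n ℕ.* (suc B ℕ.+ c) ℕ.+ suc B)
    from zero i i+0≡N j with ≡.refl ← ≡.trans (≡.sym (ℕ.+-identityʳ i)) i+0≡N =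
      _ , _ , whileDone (exit j) , j , ℕ.≤-refl
    from (suc n) i i+n≡N j with body i (≡.subst (i ℕ.<_) i+n≡N (ℕ.m<m+n i (s≤s z≤n))) j
    ... | continue , _ , t₁ , r₁ , j₁ , t₁≤c with from n (suc i) (≡.trans (≡.sym (ℕ.+-suc i n)) i+n≡N) j₁
    ... | _ , t₂ , r₂ , j₂ , t₂≤ = _ , _ , whileLoop continue r₁ r₂ , j₂ , s≤s (begin
      B ℕ.+ (t₁ ℕ.+ t₂)                             ≤⟨ ℕ.+-monoʳ-≤ B (ℕ.+-mono-≤ t₁≤c t₂≤) ⟩
      B ℕ.+ (c ℕ.+ (n ℕ.* (suc B ℕ.+ c) ℕ.+ suc B)) ≡⟨ ℕ.+-assoc B c _ ⟨
      (B ℕ.+ c) ℕ.+ (n ℕ.* (suc B ℕ.+ c) ℕ.+ suc B) ≡⟨ ℕ.+-assoc (B ℕ.+ c) _ (suc B) ⟨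
      (B ℕ.+ c) ℕ.+ n ℕ.* (suc B ℕ.+ c) ℕ.+ suc B   ∎)

  exec-for : ∀ m x N (J : ℕ → State → Set) →
    (∀ {i s} → J i s → int s m ≡ N × int s x ≡ i) →
    (∀ i {s} → i ℕ.< N → J i s → Exec P s (J (suc i)) c) →
    ∀ {s} → J 0 s → Exec (WHILE neg (reg m ≤ᵢ reg x) DO P) s (J N) (N ℕ.* (5 ℕ.+ c) ℕ.+ 5)
  exec-for m x N J regs body = exec-while N J
    (λ i i<N j → ≡.trans (test j) (≡.cong not (dec-false (N ℕ.≤? i) (ℕ.<⇒≱ i<N))) , body i i<N j)
    (λ j → ≡.trans (test j) (≡.cong not (dec-true (N ℕ.≤? N) ℕ.≤-refl)))
    where
    test : ∀ {i s} → J i s → not (does (int s m ℕ.≤? int s x)) ≡ not (does (N ℕ.≤? i))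
    test j = let (m≡N , x≡i) = regs j in ≡.cong₂ (λ u v → not (does (u ℕ.≤? v))) m≡N x≡i

-- Correctness of filling one table.

module Table (ℝ : RealNumbers) {d n′ n″ : ℕ}
             (σ : KDTW.Curve ℝ d (suc n′)) (τ : KDTW.Curve ℝ d (suc n″)) where
  open RealNumbers ℝ using (Carrier; 0#; _≤?_)
  open Execution ℝ
  open Thresholds ℝ using (lift)
  open Costs ℝ σ τ
  open Hoare ℝ σ τ

  real-updated : ∀ a i v s → real (setReal a i v s) a i ≡ v
  real-updated a i v s rewrite dec-true (a ℕ.≟ a) ≡.refl | dec-true (i ℕ.≟ i) ≡.refl = ≡.refl

  real-other : ∀ a {i j} v s → ¬ i ≡ j → real (setReal a i v s) a j ≡ real s a j
  real-other a {i} {j} v s i≢j rewrite dec-true (a ℕ.≟ a) ≡.refl | dec-false (i ℕ.≟ j) i≢j = ≡.refl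

  -- The frame condition of `fillTable`: lengths, k, ε, the largest and current thresholds and the
  -- best value survive. Registers 4 and 5 and arrays 1 to 3 are scratch space.
  Agree : State → State → Set
  Agree s₀ s = int s 0 ≡ int s₀ 0 × int s 1 ≡ int s₀ 1 × int s 2 ≡ int s₀ 2
             × real s 0 0 ≡ real s₀ 0 0 × real s 4 0 ≡ real s₀ 4 0
             × real s 5 0 ≡ real s₀ 5 0 × real s 6 0 ≡ real s₀ 6 0

  module _ (s₀ : State) (m′-known : int s₀ 0 ≡ suc n′) (m″-known : int s₀ 1 ≡ suc n″)
           (e : RealExp) (thr : Carrier → Carrier)
           (e-correct : ∀ s → Agree s₀ s → evalᵣ σ τ e s ≡ thr (real s 3 0)) where

    -- Array 1 is overwritten up to column `b` only. The equations with `suc` make `above` and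
    -- `diag` vacuous where no such neighbour exists.
    record RowFilled (a b : ℕ) (s : State) : Set where
      field
        agree : Agree s₀ s
        row≡  : int s 4 ≡ a
        col≡  : int s 5 ≡ b
        done  : ∀ b′ → b′ ℕ.< b → real s 1 b′ ≡ toGo thr a b′
        above : ∀ a₀ → a ≡ suc a₀ → ∀ b′ → b ℕ.≤ b′ → b′ ℕ.≤ n″ → real s 1 b′ ≡ toGo thr a₀ b′
        diag  : ∀ a₀ b₀ → a ≡ suc a₀ → b ≡ suc b₀ → real s 2 0 ≡ toGo thr a₀ b₀

    -- The argument of `enter` in `toGo`, split off because the program stores it before it looks at
    -- the distance.
    incoming : ℕ → ℕ → Carrier
    incoming zero    zero    = 0#
    incoming zero    (suc b) = toGo thr zero b
    incoming (suc a) zero    = toGo thr a zero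
    incoming (suc a) (suc b) =
      minimum (minimum (toGo thr a (suc b)) (toGo thr (suc a) b)) (toGo thr a b)

    toGo-incoming : ∀ a b → toGo thr a b ≡ enter thr (weight a b) (incoming a b)
    toGo-incoming zero    zero    = ≡.refl
    toGo-incoming zero    (suc b) = ≡.refl
    toGo-incoming (suc a) zero    = ≡.refl
    toGo-incoming (suc a) (suc b) = ≡.refl

    private
      set : ∀ {s r v} → evalᵣ σ τ r s ≡ v →
            Exec (3 [ lit 0 ]≔ r) s (_≡ setReal 3 0 v s) (2 ℕ.+ sizeᵣ r)
      set ≡.refl = exec-real ≡.refl

      impossible : ∀ {A : Set} {b} → b ≡ true → b ≡ false → A
      impossible ≡.refl ()

    exec-choosePredecessor : ∀ a b {s} → b ℕ.≤ n″ → RowFilled a b s →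
      Exec choosePredecessor s (_≡ setReal 3 0 (incoming a b) s) (steps choosePredecessor)
    exec-choosePredecessor zero zero b≤ inv =
      exec-if _ (λ _ → exec-if _ (λ _ → set ≡.refl) (impossible (≡.cong (λ x → does (x ℕ.≤? 0)) col≡)))
                (impossible (≡.cong (λ x → does (x ℕ.≤? 0)) row≡))
      where open RowFilled inv
    exec-choosePredecessor zero (suc b) {s} b≤ inv =
      exec-if _ (λ _ → exec-if _ (λ eq → impossible eq (≡.cong (λ x → does (x ℕ.≤? 0)) col≡))
                                 (λ _ → set left≡))
                (impossible (≡.cong (λ x → does (x ℕ.≤? 0)) row≡))
      where
      open RowFilled inv
      left≡ : real s 1 (int s 5 ℕ.∸ 1) ≡ toGo thr 0 b
      left≡ = ≡.trans (≡.cong (λ x → real s 1 (x ℕ.∸ 1)) col≡) (done b ℕ.≤-refl)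
    exec-choosePredecessor (suc a) zero {s} b≤ inv =
      exec-if _ (λ eq → impossible eq (≡.cong (λ x → does (x ℕ.≤? 0)) row≡))
                (λ _ → exec-if _ (λ _ → set up≡) (impossible (≡.cong (λ x → does (x ℕ.≤? 0)) col≡)))
      where
      open RowFilled inv
      up≡ : real s 1 (int s 5) ≡ toGo thr a 0
      up≡ = ≡.trans (≡.cong (real s 1) col≡) (above a ≡.refl 0 z≤n z≤n)
    exec-choosePredecessor (suc a) (suc b) {s} b≤ inv =
      exec-if _ (λ eq → impossible eq (≡.cong (λ x → does (x ℕ.≤? 0)) row≡))
        (λ _ → exec-if _ (λ eq → impossible eq (≡.cong (λ x → does (x ℕ.≤? 0)) col≡))
          (λ _ → exec-if _
            (λ l≤u → exec-if _
              (λ d≤l → set (sel l≤u d≤l))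
              (λ d≰l → set (sel l≤u d≰l)))
            (λ l≰u → exec-if _
              (λ d≤u → set (sel l≰u d≤u))
              (λ d≰u → set (sel l≰u d≰u)))))
      where
      open RowFilled inv
      U = real s 1 (int s 5)
      L = real s 1 (int s 5 ℕ.∸ 1)
      D = real s 2 0

      left≡ : L ≡ toGo thr (suc a) b
      left≡ = ≡.trans (≡.cong (λ x → real s 1 (x ℕ.∸ 1)) col≡) (done b ℕ.≤-refl)
      up≡ : U ≡ toGo thr a (suc b)
      up≡ = ≡.trans (≡.cong (real s 1) col≡) (above a ≡.refl (suc b) ℕ.≤-refl b≤)

      -- With the outcomes of both tests as variables, one equation serves all four leaves of the
      -- nested conditional.
      sel : ∀ {β γ} → does (L ≤? U) ≡ β → does (D ≤? (if β then L else U)) ≡ γ →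
            (if γ then D else if β then L else U) ≡ incoming (suc a) (suc b)
      sel ≡.refl ≡.refl = ≡.cong₂ minimum (≡.cong₂ minimum up≡ left≡) (diag a b ≡.refl ≡.refl)

    exec-enterCell : ∀ a b {s} → Agree s₀ s → int s 4 ≡ a → int s 5 ≡ b → real s 3 0 ≡ incoming a b →
      Exec (enterCell e) s (_≡ setReal 1 b (toGo thr a b) s) (steps (enterCell e))
    exec-enterCell a b {s} agree@(m′≡ , m″≡ , _) row≡ col≡ pred≡ = exec-if _
      -- `lift` branches on the same test, so replacing that test by its outcome in `value` leaves
      -- the formula of this branch.
      (λ eq → write (≡.trans (≡.cong (λ β → if β then p else p + (w - θ)) (≡.sym eq)) value))
      (λ eq → write (≡.trans (≡.cong (λ β → if β then p else p + (w - θ)) (≡.sym eq)) value))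
      where
      open RealNumbers ℝ using (_+_; _-_)
      w = evalᵣ σ τ distanceHere s
      θ = evalᵣ σ τ e s
      p = real s 3 0

      write : ∀ {r} → evalᵣ σ τ r s ≡ toGo thr a b →
              Exec (1 [ reg 5 ]≔ r) s (_≡ setReal 1 b (toGo thr a b) s) (2 ℕ.+ sizeᵣ r)
      write eq = exec-real (≡.cong₂ (λ i v → setReal 1 i v s) col≡ eq)

      w≡ : w ≡ weight a b
      w≡ = ≡.cong₂ (distance σ τ)
        (≡.cong₂ (λ m i → m ℕ.∸ 1 ℕ.∸ i) (≡.trans m′≡ m′-known) row≡)
        (≡.cong₂ (λ m j → m ℕ.∸ 1 ℕ.∸ j) (≡.trans m″≡ m″-known) col≡)

      value : lift θ w p ≡ toGo thr a b
      value rewrite e-correct s agree | w≡ | pred≡ = ≡.sym (toGo-incoming a b)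

    exec-cell : ∀ a b {s} → b ℕ.≤ n″ → RowFilled a b s →
      Exec (cell e) s (RowFilled a (suc b)) (steps (cell e))
    exec-cell a b {s} b≤ inv =
      exec-seq (exec-choosePredecessor a b b≤ inv) λ { ≡.refl →
      exec-seq (exec-real {Q = _≡ s₂} ≡.refl) λ { ≡.refl →
      exec-seq (exec-enterCell a b {s₂} agree row≡ col≡ ≡.refl) λ { ≡.refl →
      exec-int (record
        { agree = agree
        ; row≡  = row≡
        ; col≡  = ≡.cong suc col≡
        ; done  = done′
        ; above = λ a₀ eq b′ b<b′ b′≤ →
            ≡.trans (real-other 1 _ s₂ (ℕ.<⇒≢ b<b′)) (above a₀ eq b′ (ℕ.<⇒≤ b<b′) b′≤)
        ; diag  = λ { a₀ b₀ eq ≡.refl → ≡.trans (≡.cong (real s 1) col≡) (above a₀ eq b ℕ.≤-refl b≤) }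
        }) }}}
      where
      open RowFilled inv
      s₁ = setReal 3 0 (incoming a b) s
      s₂ = setReal 2 0 (real s 1 (int s 5)) s₁

      done′ : ∀ b′ → b′ ℕ.< suc b → real (setReal 1 b (toGo thr a b) s₂) 1 b′ ≡ toGo thr a b′
      done′ b′ (s≤s b′≤b) with b ℕ.≟ b′
      ... | yes ≡.refl = real-updated 1 b (toGo thr a b) s₂
      ... | no  b≢b′   = ≡.trans (real-other 1 _ s₂ b≢b′) (done b′ (ℕ.≤∧≢⇒< b′≤b (λ eq → b≢b′ (≡.sym eq))))

    exec-fillRow : ∀ a {s} → RowFilled a 0 s →
      Exec (fillRow e) s (RowFilled a (suc n″)) (suc n″ ℕ.* cellTime e ℕ.+ 5)
    exec-fillRow a = exec-for 1 5 (suc n″) (RowFilled a)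
      (λ inv → let open RowFilled inv in ≡.trans (proj₁ (proj₂ agree)) m″-known , col≡)
      (λ { b (s≤s b≤n″) inv → exec-cell a b b≤n″ inv })

    record RowsFilled (a : ℕ) (s : State) : Set where
      field
        agree : Agree s₀ s
        row≡  : int s 4 ≡ a
        above : ∀ a₀ → a ≡ suc a₀ → ∀ b′ → b′ ℕ.≤ n″ → real s 1 b′ ≡ toGo thr a₀ b′

    exec-nextRow : ∀ a {s} → RowsFilled a s →
      Exec (5 ≔ lit 0 ⨾ fillRow e ⨾ 4 ≔ lit 1 ⊕ reg 4) s (RowsFilled (suc a))
           (2 ℕ.+ (suc n″ ℕ.* cellTime e ℕ.+ 5 ℕ.+ 4))
    exec-nextRow a {s} inv =
      exec-seq (exec-int {Q = RowFilled a 0} (record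
        { agree = agree
        ; row≡  = row≡
        ; col≡  = ≡.refl
        ; done  = λ _ ()
        ; above = λ a₀ eq b′ _ b′≤ → above a₀ eq b′ b′≤
        ; diag  = λ _ _ _ ()
        })) λ inv′ →
      exec-seq (exec-fillRow a inv′) λ inv″ → let module F = RowFilled inv″ in
      exec-int (record
        { agree = F.agree
        ; row≡  = ≡.cong suc F.row≡
        ; above = λ { _ ≡.refl b′ b′≤ → F.done b′ (s≤s b′≤) }
        })
      where open RowsFilled inv

    -- Remains of an earlier table in array 1 do no harm: at row 0 the invariant asserts nothing
    -- about it.
    exec-fillTable : Exec (fillTable e) s₀ (λ s → Agree s₀ s × real s 1 n″ ≡ toGo thr n′ n″)
                          (suc n′ ℕ.* (suc n″ ℕ.* tableTime e))
    exec-fillTable = exec-weaken (absorb₂ n′ n″ (cellTime e)) (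
      exec-seq (exec-int {Q = RowsFilled 0} (record
        { agree = ≡.refl , ≡.refl , ≡.refl , ≡.refl , ≡.refl , ≡.refl , ≡.refl
        ; row≡  = ≡.refl
        ; above = λ _ ()
        })) λ inv →
      exec-map (λ inv′ → let open RowsFilled inv′ in agree , above n′ ≡.refl n″ ℕ.≤-refl)
        (exec-for 0 4 (suc n′) RowsFilled
          (λ inv → let open RowsFilled inv in ≡.trans (proj₁ agree) m′-known , row≡)
          (λ a _ → exec-nextRow a) inv))

-- Correctness and running time of the whole program.

-- Here `c` counts tables, `a` is the time per cell, `M` the number of cells and `y` the factor L/ε.
timeBound : (ℝ : RealNumbers) → let open RealNumbers ℝ in
  ∀ {t} c a M {y} → 0# ≤ y → t ℕ.≤ c ℕ.* (a ℕ.* M) → fromNat c ≤ fromNat 6 * y →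
  fromNat t ≤ fromNat (6 ℕ.* a ℕ.* M) * y
timeBound ℝ {t} c a M {y} 0≤y t≤ c≤ = begin
  fromNat t                                 ≤⟨ fromNat-mono t≤ ⟩
  fromNat (c ℕ.* (a ℕ.* M))                 ≈⟨ ×1-homo-* c (a ℕ.* M) ⟩
  fromNat c * fromNat (a ℕ.* M)             ≤⟨ *-monoˡ-≤ (fromNat-nonNeg (a ℕ.* M)) c≤ ⟩
  fromNat 6 * y * fromNat (a ℕ.* M)
    ≈⟨ solve 3 (λ u v w → u :* v :* w := u :* w :* v) refl (fromNat 6) y _ ⟩
  fromNat 6 * fromNat (a ℕ.* M) * y         ≈⟨ *-congʳ (×1-homo-* 6 (a ℕ.* M)) ⟨
  fromNat (6 ℕ.* (a ℕ.* M)) * y             ≡⟨ ≡.cong (λ n → fromNat n * y) (ℕ.*-assoc 6 a M) ⟨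
  fromNat (6 ℕ.* a ℕ.* M) * y               ∎
  where
  open RealNumbers ℝ
  open RealProperties ℝ

module Correctness (ℝ : RealNumbers) {d n′ n″ : ℕ}
    (σ : KDTW.Curve ℝ d (suc n′)) (τ : KDTW.Curve ℝ d (suc n″)) (k : ℕ) (1≤k : 1 ℕ.≤ k)
    (ε : RealNumbers.Carrier ℝ) (0<ε : RealNumbers._<_ ℝ (RealNumbers.0# ℝ) ε) where
  open RealNumbers ℝ
  open KDTW ℝ
  open Execution ℝ
  open RealProperties ℝ using (≤-refl; ≤-trans; ≰⇒≥; 0≤1; ⁻¹-nonNeg)
  open Costs ℝ σ τ
  open Grid ℝ
  open Approximation ℝ σ τ k 1≤k
  open Hoare ℝ σ τ
  open Table ℝ σ τ

  private
    OPT = kDTW k σ τ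

    0≤ε : 0# ≤ ε
    0≤ε = proj₁ 0<ε

    θ : ℕ → Carrier
    θ = grid (θ₀ 0≤ε) ε

    -- Kept abstract so that the constant tableTime threshold is never unfolded.
    abstract
      X : ℕ
      X = suc n′ ℕ.* (suc n″ ℕ.* tableTime threshold)

      X≡ : X ≡ suc n′ ℕ.* (suc n″ ℕ.* tableTime threshold)
      X≡ = ≡.refl

  Inputs : State → Set
  Inputs s = int s 0 ≡ suc n′ × int s 1 ≡ suc n″ × int s 2 ≡ k × real s 0 0 ≡ ε

  inputs-Agree : ∀ {s s′} → Agree s s′ → Inputs s → Inputs s′
  inputs-Agree (a , b , c , e , _) (a′ , b′ , c′ , e′) =
    ≡.trans a a′ , ≡.trans b b′ , ≡.trans c c′ , ≡.trans e e′

  lastCell≡ : ∀ {s v} → Inputs s → real s 1 n″ ≡ v → evalᵣ σ τ lastCell s ≡ v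
  lastCell≡ {s} (_ , m″≡ , _) eq = ≡.trans (≡.cong (λ m → real s 1 (m ℕ.∸ 1)) m″≡) eq

  exec-fréchet : ∀ {s} → Inputs s →
    Exec (fillTable predecessor) s (λ s′ → Inputs s′ × evalᵣ σ τ lastCell s′ ≡ fréchet) X
  exec-fréchet {s} inputs@(m′≡ , m″≡ , _) = exec-map
    (λ {s′} (agree , eq) →
      let inputs′ = inputs-Agree {s} {s′} agree inputs in inputs′ , lastCell≡ {s′} inputs′ eq)
    (exec-weaken (ℕ.≤-reflexive (≡.sym X≡))
      (exec-fillTable s m′≡ m″≡ predecessor (λ p → p) λ _ _ → ≡.refl))

  exec-value : ∀ {s ϑ} → Inputs s → real s 5 0 ≡ ϑ →
    Exec (fillTable threshold) s (λ s′ → Agree s s′ × Inputs s′ × evalᵣ σ τ valueHere s′ ≡ value ϑ) X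
  exec-value {s} {ϑ} inputs@(m′≡ , m″≡ , _) ϑ≡ = exec-map
    (λ {s′} (agree@(_ , _ , _ , _ , _ , t≡ , _) , eq) →
      let inputs′@(_ , _ , k≡ , _) = inputs-Agree {s} {s′} agree inputs
      in agree , inputs′
         , ≡.cong₂ _+_ (≡.cong₂ (λ n t → fromNat n * t) k≡ (≡.trans t≡ ϑ≡)) (lastCell≡ {s′} inputs′ eq))
    (exec-weaken (ℕ.≤-reflexive (≡.sym X≡))
      (exec-fillTable s m′≡ m″≡ threshold (λ _ → ϑ) λ _ (_ , _ , _ , _ , _ , t≡ , _) → ≡.trans t≡ ϑ≡))

  -- `lower` survives every replacement because each `value` bounds `OPT` from above; `upper`
  -- compares with all thresholds tried so far.
  record Searched (i : ℕ) (s : State) : Set where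
    field
      inputs     : Inputs s
      largest≡   : real s 4 0 ≡ fréchet
      threshold≡ : real s 5 0 ≡ θ i
      lower      : OPT ≤ real s 6 0
      upper      : ∀ j → j ℕ.≤ i → real s 6 0 ≤ value (θ j)

  exec-improve : ∀ i {s} → Inputs s → real s 4 0 ≡ fréchet → real s 5 0 ≡ θ (suc i) →
    OPT ≤ real s 6 0 → (∀ j → j ℕ.≤ i → real s 6 0 ≤ value (θ j)) →
    evalᵣ σ τ valueHere s ≡ value (θ (suc i)) →
    Exec improve s (Searched (suc i)) (steps improve)
  exec-improve i {s} inputs largest≡ threshold≡ lower upper value≡ = exec-if _
    (λ kept → exec-skip (record
      { inputs = inputs ; largest≡ = largest≡ ; threshold≡ = threshold≡ ; lower = lower
      ; upper  = extend upper (≡.subst (_ ≤_) value≡ (does-true kept)) }))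
    (λ replaced → exec-real (record
      { inputs = inputs ; largest≡ = largest≡ ; threshold≡ = threshold≡
      ; lower  = ≡.subst (OPT ≤_) (≡.sym value≡) (kDTW≤value (grid-nonNeg 0≤ε (suc i)))
      ; upper  = extend (λ j j≤i → ≤-trans (does-false replaced) (upper j j≤i))
                        (≡.subst (_≤ value (θ (suc i))) (≡.sym value≡) ≤-refl) }))
    where
    does-true : ∀ {x y} → does (x ≤? y) ≡ true → x ≤ y
    does-true {x} {y} eq with x ≤? y
    does-true ≡.refl | yes x≤y = x≤y

    does-false : ∀ {x y} → does (x ≤? y) ≡ false → y ≤ x
    does-false {x} {y} eq with x ≤? y
    does-false ≡.refl | no x≰y = ≰⇒≥ x≰y

    extend : ∀ {b} → (∀ j → j ℕ.≤ i → b ≤ value (θ j)) → b ≤ value (θ (suc i)) →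
             ∀ j → j ℕ.≤ suc i → b ≤ value (θ j)
    extend old new j j≤1+i with ℕ.m≤n⇒m<n∨m≡n j≤1+i
    ... | inj₁ (s≤s j≤i) = old j j≤i
    ... | inj₂ ≡.refl    = new

  exec-refine : ∀ i {s} → Searched i s → Exec refine s (Searched (suc i)) (10 ℕ.+ (X ℕ.+ steps improve))
  exec-refine i {s} searched =
    exec-seq (exec-real {Q = _≡ s₁} ≡.refl) λ { ≡.refl →
    exec-seq (exec-value {s₁} inputs threshold₁≡) λ ((_ , _ , _ , _ , l≡ , t≡ , b≡) , inputs′ , value≡) →
    exec-improve i inputs′ (≡.trans l≡ largest≡)
      (≡.trans t≡ threshold₁≡)
      (≡.subst (OPT ≤_) (≡.sym b≡) lower)
      (λ j j≤i → ≡.subst (_≤ value (θ j)) (≡.sym b≡) (upper j j≤i))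
      value≡ }
    where
    open Searched searched
    s₁ = setReal 5 0 (real s 5 0 * (fromNat 1 + real s 0 0)) s

    threshold₁≡ : real s₁ 5 0 ≡ θ (suc i)
    threshold₁≡ = ≡.cong₂ (λ t e → t * (fromNat 1 + e)) threshold≡ (proj₂ (proj₂ (proj₂ inputs)))

  exec-search : ∀ N → fréchet ≤ θ N → (∀ i → i ℕ.< N → ¬ fréchet ≤ θ i) → ∀ {s} → Searched 0 s →
    Exec (WHILE neg (largest ≤ᵣ threshold) DO refine) s (Searched N)
         (N ℕ.* (7 ℕ.+ (10 ℕ.+ (X ℕ.+ steps improve))) ℕ.+ 7)
  exec-search N F≤ below = exec-while N Searched
    (λ i i<N searched →
        ≡.trans (test searched) (≡.cong not (dec-false (fréchet ≤? θ i) (below i i<N)))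
      , exec-refine i searched)
    (λ searched → ≡.trans (test searched) (≡.cong not (dec-true (fréchet ≤? θ N) F≤)))
    where
    test : ∀ {i s} → Searched i s → not (does (real s 4 0 ≤? real s 5 0)) ≡ not (does (fréchet ≤? θ i))
    test searched = let open Searched searched in ≡.cong₂ (λ u v → not (does (u ≤? v))) largest≡ threshold≡

  exec-algorithm : ∀ N → fréchet ≤ θ N → (∀ i → i ℕ.< N → ¬ fréchet ≤ θ i) →
    Exec algorithm (initial σ τ k ε)
      (λ s → OPT ≤ output s × output s ≤ (1# + ε) * OPT)
      ((2 ℕ.+ N) ℕ.* (perCellTime ℕ.* (suc n′ ℕ.* suc n″)))
  exec-algorithm N F≤ below = exec-weaken time (
    exec-seq (exec-fréchet (≡.refl , ≡.refl , ≡.refl , ≡.refl)) λ (inputs₁ , F≡) →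
    exec-seq (exec-real {Q = λ s → Inputs s × real s 4 0 ≡ fréchet} (inputs₁ , F≡)) λ (inputs₂ , F≡) →
    exec-seq (exec-real {Q = λ s → Inputs s × real s 4 0 ≡ fréchet × real s 5 0 ≡ θ 0}
      (inputs₂ , F≡ , ≡.cong₂ (λ x n → x / fromNat n)
        (≡.cong₂ _*_ (proj₂ (proj₂ (proj₂ inputs₂))) F≡) (proj₁ (proj₂ (proj₂ inputs₂)))))
      λ (inputs₃ , F≡ , θ≡) →
    exec-seq (exec-value inputs₃ θ≡) λ ((_ , _ , _ , _ , l≡ , t≡ , _) , inputs₄ , value≡) →
    exec-seq (exec-real {Q = Searched 0} (record
      { inputs     = inputs₄
      ; largest≡   = ≡.trans l≡ F≡
      ; threshold≡ = ≡.trans t≡ θ≡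
      ; lower      = ≡.subst (OPT ≤_) (≡.sym value≡) (kDTW≤value (grid-nonNeg 0≤ε 0))
      ; upper      = λ { zero z≤n → ≡.subst (_≤ value (θ 0)) (≡.sym value≡) ≤-refl }
      })) λ searched₀ →
    exec-seq (exec-search N F≤ below searched₀) λ searched →
    exec-real (let open Searched searched
                   -- The index `i` depends on an optimal traversal, which the program never learns;
                   -- `upper` covers every index tried.
                   (i , i≤N , approximates) = grid-approximates 0≤ε N F≤
               in lower , ≤-trans (upper i i≤N) approximates))
    where
    open ℕ.≤-Reasoning
    M = suc n′ ℕ.* suc n″

    X≡M*tableTime : X ≡ tableTime threshold ℕ.* M
    X≡M*tableTime = ≡.trans X≡
      (≡.trans (≡.sym (ℕ.*-assoc (suc n′) (suc n″) (tableTime threshold)))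
               (ℕ.*-comm M (tableTime threshold)))

    time : X ℕ.+ (6 ℕ.+ (10 ℕ.+ (X ℕ.+ (12 ℕ.+ ((N ℕ.* (7 ℕ.+ (10 ℕ.+ (X ℕ.+ 27))) ℕ.+ 7) ℕ.+ 4)))))
           ℕ.≤ (2 ℕ.+ N) ℕ.* (perCellTime ℕ.* M)
    time = begin
      X ℕ.+ (6 ℕ.+ (10 ℕ.+ (X ℕ.+ (12 ℕ.+ ((N ℕ.* (7 ℕ.+ (10 ℕ.+ (X ℕ.+ 27))) ℕ.+ 7) ℕ.+ 4)))))
        -- The added summand is the exact difference from `(2 + N) * (X + 100)`.
        ≤⟨ ℕ.m≤m+n _ (N ℕ.* 56 ℕ.+ 161) ⟩
      X ℕ.+ (6 ℕ.+ (10 ℕ.+ (X ℕ.+ (12 ℕ.+ ((N ℕ.* (7 ℕ.+ (10 ℕ.+ (X ℕ.+ 27))) ℕ.+ 7) ℕ.+ 4)))))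
        ℕ.+ (N ℕ.* 56 ℕ.+ 161)
        ≡⟨ collect X N ⟩
      (2 ℕ.+ N) ℕ.* (X ℕ.+ 100)
        ≡⟨ ≡.cong (λ x → (2 ℕ.+ N) ℕ.* (x ℕ.+ 100)) X≡M*tableTime ⟩
      (2 ℕ.+ N) ℕ.* (tableTime threshold ℕ.* M ℕ.+ 100)
        ≤⟨ ℕ.*-monoʳ-≤ (2 ℕ.+ N) (ℕ.+-monoʳ-≤ (tableTime threshold ℕ.* M) (ℕ.m≤m*n 100 M)) ⟩
      (2 ℕ.+ N) ℕ.* (tableTime threshold ℕ.* M ℕ.+ 100 ℕ.* M)
        ≡⟨ ≡.cong ((2 ℕ.+ N) ℕ.*_) (ℕ.*-distribʳ-+ M (tableTime threshold) 100) ⟨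
      (2 ℕ.+ N) ℕ.* (perCellTime ℕ.* M) ∎
      where
      collect : ∀ X N →
        X ℕ.+ (6 ℕ.+ (10 ℕ.+ (X ℕ.+ (12 ℕ.+ ((N ℕ.* (7 ℕ.+ (10 ℕ.+ (X ℕ.+ 27))) ℕ.+ 7) ℕ.+ 4)))))
          ℕ.+ (N ℕ.* 56 ℕ.+ 161) ≡ (2 ℕ.+ N) ℕ.* (X ℕ.+ 100)
      collect = solve-∀

  module _ (ε≤1 : ε ≤ 1#) where
    private
      y = (1# ⊔ log₂ (fromNat k / ε)) / ε
      M = suc n′ ℕ.* suc n″

      0≤y : 0# ≤ y
      0≤y = *-nonNeg (≤-trans 0≤1 (x≤x⊔y 1# _)) (⁻¹-nonNeg 0<ε)

      Bounded : Set
      Bounded = ∃[ s ] ∃[ t ] ( Run σ τ algorithm (initial σ τ k ε) s t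
        × OPT ≤ output s
        × output s ≤ (1# + ε) * OPT
        × fromNat t ≤ fromNat (6 ℕ.* perCellTime ℕ.* M) * y )

      conclude : ∀ N → fromNat (2 ℕ.+ N) ≤ fromNat 6 * y →
        Exec algorithm (initial σ τ k ε) (λ s → OPT ≤ output s × output s ≤ (1# + ε) * OPT)
          ((2 ℕ.+ N) ℕ.* (perCellTime ℕ.* M)) →
        Bounded
      conclude N N≤ (s , t , run , (lower , upper) , t≤) =
        s , t , run , lower , upper , timeBound ℝ (2 ℕ.+ N) perCellTime M 0≤y t≤ N≤

    algorithm-approximates : Bounded
    algorithm-approximates =
      let (N , F≤ , below , N≤) =
            gridSize 0<ε ε≤1 (fromNat k / ε) (θ₀-nonNeg 0≤ε) (fréchet≈θ₀*[k/ε] 0<ε)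
      in conclude N N≤ (exec-algorithm N F≤ below)

theorem3p4 :
    ∃[ P ] ∃[ C ]
    ((ℝ : RealNumbers) →
      let open RealNumbers ℝ
          open KDTW ℝ
          open Execution ℝ
      in
      (d n′ n″ : ℕ) (σ : Curve d (suc n′)) (τ : Curve d (suc n″))
      (k : ℕ) → 1 ℕ.≤ k →
      (ε : Carrier) → 0# < ε → ε ≤ 1# →
      ∃[ s ] ∃[ t ]
        ( Run σ τ P (initial σ τ k ε) s t
        × kDTW k σ τ ≤ output s
        × output s ≤ (1# + ε) * kDTW k σ τ
        × fromNat t ≤ fromNat (C ℕ.* (suc n′ ℕ.* suc n″)) * ((1# ⊔ log₂ (fromNat k / ε)) / ε)))
-- The 6 bounds the number of tables in units of L/ε; the other factor is the time per cell.
theorem3p4 = algorithm , 6 ℕ.* perCellTime , λ ℝ d n′ n″ σ τ k 1≤k ε 0<ε ε≤1 →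
  Correctness.algorithm-approximates ℝ σ τ k 1≤k ε 0<ε ε≤1
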